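{- Let $\mathbb T$ be a theory and $\Gamma\in\mathsf{Ctx}$. (1) If $\Gamma\vdash t:T$, then $\Gamma\vdash t'\Leftarrow T$ for some minimal $t'\in\mathsf{Tm}^{\mathsf c}\,|\Gamma|$ with $\ulcorner t'\urcorner=t$. (2) If $\Gamma\vdash t:T$, then $\Gamma\vdash t'\Rightarrow T'$ for some $T'\equiv T$ and some minimal $t'\in\mathsf{Tm}^{\mathsf i}\,|\Gamma|$ with $\ulcorner t'\urcorner=t$. (3) If $\Gamma\vdash T\ \mathsf{sort}$, then $\Gamma\vdash T'\Leftarrow\mathsf{sort}$ for some minimal $T'\in\mathsf{Tm}^{\mathsf c}\,|\Gamma|$ with $\ulcorner T'\urcorner=T$. (4) If $\Gamma\vdash\mathbf v,\mathbf t:\Theta.\Xi$, then $\Gamma\mid\mathbf v:\Theta\vdash\mathbf t'\Leftarrow\Xi$ for some minimal $\mathbf t'\in\mathsf{MSub}^{\mathsf c}\,|\Gamma|\,|\Xi|$ with $\ulcorner\mathbf t'\urcorner=\mathbf t$.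
   Context: **Syntax.** Expressions are taken up to renaming of bound variables (equivalently, de Bruijn indices) and implicitly weakened to larger scopes; concatenated scopes are regarded as disjoint. A scope $\gamma$ is a finite list of variables; a metavariable scope $\theta$ is a finite list of entries $\mathtt x\{\delta\}$ with $\delta$ a scope; a signature $\Sigma$ is a finite list of entries $o(\theta)$, where each operation $o$ is either a constructor (written $c$) or a destructor (written $d$). Concatenation is written with a dot, $\cdot$ is the empty list. For fixed $\Sigma$, by mutual induction: terms $\mathsf{Tm}\,\theta\,\gamma$ are $x$ ($x\in\gamma$), $\mathtt x\{\vec t\}$ ($\mathtt x\{\delta\}\in\theta$, $\vec t\in\mathsf{Sub}\,\theta\,\gamma\,\delta$), $o(\mathbf t)$ ($o(\xi)\in\Sigma$, $\mathbf t\in\mathsf{MSub}\,\theta\,\gamma\,\xi$); substitutions $\mathsf{Sub}\,\theta\,\gamma\,\delta$ are lists of terms in $\mathsf{Tm}\,\theta\,\gamma$, one $t_x$ for each $x\in\delta$; metavariable substitutions $\mathsf{MSub}\,\theta\,\gamma\,\xi$ are lists with one entry $\vec x_\delta.t$, $t\in\mathsf{Tm}\,\theta\,(\gamma.\delta)$ (variables of $\delta$ bound), for each $\mathtt x\{\delta\}\in\xi$, and $\mathbf t_{\mathtt x}$ denotes this $t$; $\varepsilon$ is the empty list. $\mathsf{Ctx}\,\theta\,\gamma$: lists $x_1:T_1,\dots,x_k:T_k$ with $T_i\in\mathsf{Tm}\,\theta\,(\gamma,x_1,\dots,x_{i-1})$; underlying scope $|\Gamma|=x_1,\dots,x_k$.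 $\mathsf{MCtx}\,\theta$: lists $\mathtt x_1\{\Gamma_1\}:T_1,\dots,\mathtt x_k\{\Gamma_k\}:T_k$ with $\Gamma_i\in\mathsf{Ctx}\,(\theta.\xi_i)\,(\cdot)$ and $T_i\in\mathsf{Tm}\,(\theta.\xi_i)\,|\Gamma_i|$, where $\xi_i=\mathtt x_1\{|\Gamma_1|\},\dots,\mathtt x_{i-1}\{|\Gamma_{i-1}|\}$; $|\Theta|=\mathtt x_1\{|\Gamma_1|\},\dots,\mathtt x_k\{|\Gamma_k|\}$. Abbreviate $\mathsf{Ctx}\,\theta=\mathsf{Ctx}\,\theta\,(\cdot)$, $\mathsf{Ctx}=\mathsf{Ctx}\,(\cdot)\,(\cdot)$, $\mathsf{MCtx}=\mathsf{MCtx}\,(\cdot)$. $\mathsf{id}_\gamma$ is the list of variables of $\gamma$; $\mathsf{id}_\theta\in\mathsf{MSub}\,\theta\,(\cdot)\,\theta$ has entry $\vec x_\delta.\mathtt x\{\mathsf{id}_\delta\}$ for each $\mathtt x\{\delta\}\in\theta$. For $\vec v\in\mathsf{Sub}\,\theta\,\gamma_1\,\gamma_2$ and $e$ over $\theta,\gamma_2$, $e[\vec v]$ (over $\theta,\gamma_1$) is capture-avoiding simultaneous substitution. For $\mathbf v\in\mathsf{MSub}\,\theta_1\,\delta\,\theta_2$ and $e$ over $\theta_2,\gamma$, $e[\mathbf v]$ (over $\theta_1,\delta.\gamma$) is defined structurally by $x[\mathbf v]=x$, $\mathtt x\{\vec t\}[\mathbf v]=\mathbf v_{\mathtt x}[\mathsf{id}_\delta,\vec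 t[\mathbf v]]$, $o(\mathbf t)[\mathbf v]=o(\mathbf t[\mathbf v])$, componentwise on lists and contexts. **Patterns and theories.** $\mathsf{Tm}^{\mathsf P}\,\theta\,\gamma$: $\mathtt x\{\mathsf{id}_\gamma\}$ if $\theta$ is exactly $\mathtt x\{\gamma\}$; or $c(\mathbf t)$ with $c(\xi)\in\Sigma$ a constructor and $\mathbf t\in\mathsf{MSub}^{\mathsf P}\,\theta\,\gamma\,\xi$. $\mathsf{MSub}^{\mathsf P}\,\theta\,\gamma\,\xi$: $\varepsilon$ if $\xi=\theta=\cdot$; or $\mathbf t,\vec x_\delta.t$ if $\xi=\xi',\mathtt x\{\delta\}$, $\theta=\theta_1.\theta_2$, $\mathbf t\in\mathsf{MSub}^{\mathsf P}\,\theta_1\,\gamma\,\xi'$, $t\in\mathsf{Tm}^{\mathsf P}\,\theta_2\,(\gamma.\delta)$. A theory $\mathbb T$, with underlying signature $|\mathbb T|$, is built from the empty theory by successively adding entries over the current signature (declared symbols pairwise distinct): sort rules $c(\Xi)\ \mathsf{sort}$ with $\Xi\in\mathsf{MCtx}$ (adds $c(|\Xi|)$ to the signature); constructor rules $c(\Xi_p;\Xi_c;\mathbf v_i/\Xi_i):T$ with $\Xi_p\in\mathsf{MCtx}$, $\Xi_c,\Xi_i\in\mathsf{MCtx}\,|\Xi_p|$, $\mathbf v_i\in\mathsf{MSub}\,|\Xi_p.\Xi_c|\,(\cdot)\,|\Xi_i|$, $T\in\mathsf{Tm}^{\mathsf P}\,|\Xi_p.\Xi_i|\,(\cdot)$ (adds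 $c(|\Xi_c|)$); destructor rules $d(\Xi_{pi};\mathtt x:T;\Xi_d):U$ with $\Xi_{pi}\in\mathsf{MCtx}$, $T\in\mathsf{Tm}^{\mathsf P}\,|\Xi_{pi}|\,(\cdot)$, $\Xi_d\in\mathsf{MCtx}\,|\Xi_{pi},\mathtt x:T|$, $U\in\mathsf{Tm}\,|\Xi_{pi}.(\mathtt x:T).\Xi_d|\,(\cdot)$ (adds $d(\mathtt x,|\Xi_d|)$); rewrite rules $\theta\Vdash d(\mathbf t)\longmapsto r$ with $d(\xi)\in|\mathbb T|$, $\mathbf t\in\mathsf{MSub}^{\mathsf P}\,\theta\,(\cdot)\,\xi$, $r\in\mathsf{Tm}\,\theta\,(\cdot)$, such that $\mathbf t[\mathbf u]\ne\mathbf t'[\mathbf u']$ for every earlier rule $\theta'\Vdash d(\mathbf t')\longmapsto r'$ and all $\mathbf u,\mathbf u'$. The relation $\longrightarrow$ is the closure under all expression formers (one component at a time, also under binders and in contexts) of $d(\mathbf u[\mathbf t])\longrightarrow r[\mathbf t]$ for $(\theta_0\Vdash d(\mathbf u)\longmapsto r)\in\mathbb T$, $\mathbf t\in\mathsf{MSub}\,\theta\,\gamma\,\theta_0$; $\longrightarrow^*$ and $\equiv$ are its reflexive-transitive and reflexive-symmetric-transitive closures. **Declarative typing** (inductively defined; $\Theta\in\mathsf{MCtx}$, $\Gamma,\Delta\in\mathsf{Ctx}\,|\Theta|$, $\Xi\in\mathsf{MCtx}$). $\cdot\vdash$; $\Theta,\mathtt x\{\Gamma\}:T\vdash$ if $\Theta;\Gamma\vdash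 T\ \mathsf{sort}$. $\Theta;\cdot\vdash$ if $\Theta\vdash$; $\Theta;\Gamma,x:T\vdash$ if $\Theta;\Gamma\vdash T\ \mathsf{sort}$. Sort: $\Theta;\Gamma\vdash c(\mathbf t)\ \mathsf{sort}$ if $c(\Xi)\ \mathsf{sort}\in\mathbb T$ and $\Theta;\Gamma\vdash\mathbf t:\Xi$. Var: $\Theta;\Gamma\vdash x:T$ if $x:T\in\Gamma$ and $\Theta;\Gamma\vdash$. MVar: $\Theta;\Gamma\vdash\mathtt x\{\vec t\}:T[\vec t]$ if $\mathtt x\{\Delta\}:T\in\Theta$ and $\Theta;\Gamma\vdash\vec t:\Delta$. Cons: $\Theta;\Gamma\vdash c(\mathbf t):T[\mathbf t_p,\mathbf v_i[\mathbf t_p,\mathbf t]]$ if $c(\Xi_p;\Xi_c;\mathbf v_i/\Xi_i):T\in\mathbb T$, $\Theta;\Gamma\vdash\mathbf t_p,\mathbf t:\Xi_p.\Xi_c$ and $\Theta;\Gamma\vdash T[\mathbf t_p,\mathbf v_i[\mathbf t_p,\mathbf t]]\ \mathsf{sort}$. Dest: $\Theta;\Gamma\vdash d(\mathbf t):U[\mathbf t_{pi},\mathbf t]$ if $d(\Xi_{pi};\mathtt x:T;\Xi_d):U\in\mathbb T$ and $\Theta;\Gamma\vdash\mathbf t_{pi},\mathbf t:\Xi_{pi}.(\mathtt x:T).\Xi_d$. Conv: $\Theta;\Gamma\vdash t:U$ if $\Theta;\Gamma\vdash t:T$, $T\equiv U$, $\Theta;\Gamma\vdash U\ \mathsf{sort}$.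 Substitutions: $\Theta;\Gamma\vdash\varepsilon:(\cdot)$ if $\Theta;\Gamma\vdash$; $\Theta;\Gamma\vdash\vec t,t:(\Delta,x:T)$ if $\Theta;\Gamma\vdash\vec t:\Delta$ and $\Theta;\Gamma\vdash t:T[\vec t]$. Metavariable substitutions: $\Theta;\Gamma\vdash\varepsilon:(\cdot)$ if $\Theta;\Gamma\vdash$; $\Theta;\Gamma\vdash\mathbf t,\vec x_\Delta.t:(\Xi,\mathtt x\{\Delta\}:T)$ if $\Theta;\Gamma\vdash\mathbf t:\Xi$ and $\Theta;\Gamma.\Delta[\mathbf t]\vdash t:T[\mathbf t]$. One writes $\Gamma\vdash\mathcal J$ for $\cdot;\Gamma\vdash\mathcal J$ and $\Theta\vdash\mathcal J$ for $\Theta;\cdot\vdash\mathcal J$. **Matching.** For $t\in\mathsf{Tm}^{\mathsf P}\,\theta\,\gamma$, $u\in\mathsf{Tm}\,(\cdot)\,(\delta.\gamma)$, $\mathbf v\in\mathsf{MSub}\,(\cdot)\,\delta\,\theta$ the judgment $t\prec u\leadsto\mathbf v$ (and similarly $\mathbf t\prec\mathbf u\leadsto\mathbf v$) is defined by: $c(\mathbf t)\prec u\leadsto\mathbf v$ if $u\longrightarrow^*c(\mathbf u)$ and $\mathbf t\prec\mathbf u\leadsto\mathbf v$; $\mathtt x\{\mathsf{id}_\gamma\}\prec u\leadsto\vec x_\gamma.u$; $\varepsilon\prec\varepsilon\leadsto\varepsilon$; $(\mathbf t,\vec x.t)\prec(\mathbf u,\vec x.u)\leadsto\mathbf v_1,\mathbf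 v_2$ if $\mathbf t\prec\mathbf u\leadsto\mathbf v_1$ and $t\prec u\leadsto\mathbf v_2$. **Bidirectional syntax.** Checkable terms $\mathsf{Tm}^{\mathsf c}\,\gamma$: $c(\mathbf t)$ with $c(\xi)\in\Sigma$, $\mathbf t\in\mathsf{MSub}^{\mathsf c}\,\gamma\,\xi$; or $\underline t$ with $t\in\mathsf{Tm}^{\mathsf i}\,\gamma$. Inferable terms $\mathsf{Tm}^{\mathsf i}\,\gamma$: $x\in\gamma$; $d(t,\mathbf t)$ with $d(\mathtt x,\xi)\in\Sigma$, $t\in\mathsf{Tm}^{\mathsf i}\,\gamma$, $\mathbf t\in\mathsf{MSub}^{\mathsf c}\,\gamma\,\xi$; ascriptions $t::T$ with $t,T\in\mathsf{Tm}^{\mathsf c}\,\gamma$. $\mathsf{MSub}^{\mathsf c}\,\gamma\,\xi$: lists with one entry $\vec x_\delta.t$, $t\in\mathsf{Tm}^{\mathsf c}\,(\gamma.\delta)$, for each $\mathtt x\{\delta\}\in\xi$. $\ulcorner-\urcorner$ is the underlying ordinary expression (over the empty metavariable scope): it erases underlining and ascriptions ($\ulcorner t::T\urcorner=\ulcorner t\urcorner$, $\ulcorner\underline t\urcorner=\ulcorner t\urcorner$). A bidirectional expression is minimal if it contains no occurrence of $\underline{t::T}$ or of $\underline t::T$. **Bidirectional typing** (inductively defined; $\Gamma\in\mathsf{Ctx}$). In $\Gamma\vdash t\Leftarrow T$ and $\Gamma\vdash t\Rightarrow T$ we have $T\in\mathsf{Tm}\,(\cdot)\,|\Gamma|$ and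 $t$ checkable, resp. inferable; in $\Gamma\vdash T\Leftarrow\mathsf{sort}$, $T$ is checkable; in $\Gamma\mid\mathbf v:\Theta\vdash\mathbf t\Leftarrow\Xi$, $\Theta\in\mathsf{MCtx}$, $\mathbf v\in\mathsf{MSub}\,(\cdot)\,|\Gamma|\,|\Theta|$, $\Xi\in\mathsf{MCtx}\,|\Theta|$, $\mathbf t\in\mathsf{MSub}^{\mathsf c}\,|\Gamma|\,|\Xi|$. Rules. Sort: $\Gamma\vdash c(\mathbf t)\Leftarrow\mathsf{sort}$ if $c(\Xi)\ \mathsf{sort}\in\mathbb T$ and $\Gamma\mid\varepsilon:(\cdot)\vdash\mathbf t\Leftarrow\Xi$. Cons: $\Gamma\vdash c(\mathbf u)\Leftarrow T'$ if $c(\Xi_p;\Xi_c;\mathbf v_i/\Xi_i):T\in\mathbb T$, $T\prec T'\leadsto\mathbf t_p,\mathbf t_i$, $\Gamma\mid\mathbf t_p:\Xi_p\vdash\mathbf u\Leftarrow\Xi_c$ and $\mathbf t_i\equiv\mathbf v_i[\mathbf t_p,\ulcorner\mathbf u\urcorner]$. Switch: $\Gamma\vdash\underline t\Leftarrow U$ if $\Gamma\vdash t\Rightarrow T$ and $T\equiv U$. Var: $\Gamma\vdash x\Rightarrow T$ if $x:T\in\Gamma$. Annot: $\Gamma\vdash t::T\Rightarrow\ulcorner T\urcorner$ if $\Gamma\vdash T\Leftarrow\mathsf{sort}$ and $\Gamma\vdash t\Leftarrow\ulcorner T\urcorner$. Dest: $\Gamma\vdash d(t,\mathbf u)\Rightarrow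 U[\mathbf t,\ulcorner t\urcorner,\ulcorner\mathbf u\urcorner]$ if $d(\Xi_{pi};\mathtt x:T;\Xi_d):U\in\mathbb T$, $\Gamma\vdash t\Rightarrow T'$, $T\prec T'\leadsto\mathbf t$ and $\Gamma\mid\mathbf t,\ulcorner t\urcorner:(\Xi_{pi},\mathtt x:T)\vdash\mathbf u\Leftarrow\Xi_d$. EmptyMSub: $\Gamma\mid\mathbf v:\Theta\vdash\varepsilon\Leftarrow(\cdot)$. ExtMSub: $\Gamma\mid\mathbf v:\Theta\vdash\mathbf t,\vec x_\Delta.t\Leftarrow(\Xi,\mathtt x\{\Delta\}:T)$ if $\Gamma\mid\mathbf v:\Theta\vdash\mathbf t\Leftarrow\Xi$ and $\Gamma.\Delta[\mathbf v,\ulcorner\mathbf t\urcorner]\vdash t\Leftarrow T[\mathbf v,\ulcorner\mathbf t\urcorner]$. -}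

module Defs where

open import Data.Fin using (Fin; zero; suc; _↑ˡ_; _↑ʳ_; splitAt)
open import Data.List using (List; []; _∷_; _++_; map)
open import Data.List.Membership.Propositional using (_∈_)
open import Data.List.Membership.Propositional.Properties using (∈-++⁺ˡ; ∈-++⁺ʳ)
open import Data.List.Relation.Binary.Subset.Propositional using (_⊆_)
open import Data.List.Relation.Unary.All using (All; []; _∷_; lookup)
open import Data.List.Relation.Unary.All.Properties using (++⁺)
open import Data.List.Relation.Unary.Any using (here; there)
open import Data.Nat using (ℕ; zero; suc; _+_)
open import Data.Nat.Properties using (+-assoc)
open import Data.Product using (_×_; _,_; proj₁; proj₂)
open import Data.Sum using ([_,_]′)
open import Data.Vec using (Vec; []; _∷_; tabulate)
import Data.Vec as Vec
open import Function using (id; _∘_)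
open import Relation.Binary.Construct.Closure.Equivalence using (EqClosure)
open import Relation.Binary.Construct.Closure.ReflexiveTransitive using (Star)
open import Relation.Binary.PropositionalEquality using (_≡_; _≢_; refl; sym; subst)

------------------------------------------------------------------------
-- Scopes and signatures

-- Everything is de Bruijn and grows at the head: the most recently
-- added entry comes first.  So the concatenation γ.δ is δ + γ on
-- variable scopes and θ.ξ is ξ ++ θ on metavariable scopes; likewise
-- "t⃗, t" is t ∷ t⃗ and "𝐯, 𝐭" is ++⁺ 𝐭 𝐯 on substitutions.

Scope : Set
Scope = ℕ

MScope : Set
MScope = List Scope

-- con ξ is an entry c(ξ); des ξ is an entry d(𝚡, ξ), whose principal
-- argument 𝚡 binds nothing.  Destructors of any other arity are never
-- declared by a theory and have no inferable form.
data Op : Set where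
  con des : MScope → Op

arity : Op → MScope
arity (con ξ) = ξ
arity (des ξ) = ξ ++ 0 ∷ []

Sig : Set
Sig = List Op

variable
  Σ Σ′       : Sig
  o          : Op
  θ θ′ ξ     : MScope
  θ₁ θ₂      : MScope
  ξp ξc ξi   : MScope
  ξd         : MScope
  γ γ′ δ     : Scope

------------------------------------------------------------------------
-- Terms and substitutions

data Tm (Σ : Sig) (θ : MScope) : Scope → Set

Sub : Sig → MScope → Scope → Scope → Set
Sub Σ θ γ δ = Vec (Tm Σ θ γ) δ

MSub : Sig → MScope → Scope → MScope → Set
MSub Σ θ γ ξ = All (λ δ → Tm Σ θ (δ + γ)) ξ

data Tm Σ θ where
  var  : Fin γ → Tm Σ θ γ
  mvar : δ ∈ θ → Sub Σ θ γ δ → Tm Σ θ γ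
  op   : o ∈ Σ → MSub Σ θ γ (arity o) → Tm Σ θ γ

idˢ : Sub Σ θ γ γ
idˢ = tabulate var

------------------------------------------------------------------------
-- Weakening (along larger signatures, metavariable scopes and scopes)

lift : ∀ δ → (Fin γ → Fin γ′) → Fin (δ + γ) → Fin (δ + γ′)
lift {γ′ = γ′} δ ρ i = [ (λ j → j ↑ˡ γ′) , (λ j → δ ↑ʳ ρ j) ]′ (splitAt δ i)

ren  : Σ ⊆ Σ′ → θ ⊆ θ′ → (Fin γ → Fin γ′) → Tm Σ θ γ → Tm Σ′ θ′ γ′
renˢ : Σ ⊆ Σ′ → θ ⊆ θ′ → (Fin γ → Fin γ′) → Sub Σ θ γ δ → Sub Σ′ θ′ γ′ δ
renᴹ : Σ ⊆ Σ′ → θ ⊆ θ′ → (Fin γ → Fin γ′) → MSub Σ θ γ ξ → MSub Σ′ θ′ γ′ ξ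

ren σ μ ρ (var x)     = var (ρ x)
ren σ μ ρ (mvar x ts) = mvar (μ x) (renˢ σ μ ρ ts)
ren σ μ ρ (op o ts)   = op (σ o) (renᴹ σ μ ρ ts)

renˢ σ μ ρ []       = []
renˢ σ μ ρ (t ∷ ts) = ren σ μ ρ t ∷ renˢ σ μ ρ ts

renᴹ σ μ ρ []                   = []
renᴹ σ μ ρ (_∷_ {x = δ} t ts) = ren σ μ (lift δ ρ) t ∷ renᴹ σ μ ρ ts

wk : ∀ δ → Tm Σ θ γ → Tm Σ θ (δ + γ)
wk δ = ren id id (δ ↑ʳ_)

------------------------------------------------------------------------
-- Substitution

liftˢ : ∀ δ → Sub Σ θ γ′ γ → Sub Σ θ (δ + γ′) (δ + γ)
liftˢ {γ′ = γ′} δ vs = tabulate (λ i → var (i ↑ˡ γ′)) Vec.++ Vec.map (wk δ) vs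

infixl 20 _[_] _[_]ˢ _[_]ᴹ

_[_]  : Tm Σ θ γ → Sub Σ θ γ′ γ → Tm Σ θ γ′
_[_]ˢ : Sub Σ θ γ δ → Sub Σ θ γ′ γ → Sub Σ θ γ′ δ
_[_]ᴹ : MSub Σ θ γ ξ → Sub Σ θ γ′ γ → MSub Σ θ γ′ ξ

var x     [ vs ] = Vec.lookup vs x
mvar x ts [ vs ] = mvar x (ts [ vs ]ˢ)
op o ts   [ vs ] = op o (ts [ vs ]ᴹ)

[]       [ vs ]ˢ = []
(t ∷ ts) [ vs ]ˢ = (t [ vs ]) ∷ (ts [ vs ]ˢ)

[]                   [ vs ]ᴹ = []
(_∷_ {x = δ} t ts) [ vs ]ᴹ = (t [ liftˢ δ vs ]) ∷ (ts [ vs ]ᴹ)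

-- Metavariable substitution e[𝐯] for e over γ and 𝐯 over δ.  The result
-- lives in δ.γ; so as not to reassociate scopes under binders, inst is
-- stated for an arbitrary scope γ′ with an embedding ρ of the variables
-- of e and an embedding κ of the variables of 𝐯.
inst  : (Fin γ → Fin γ′) → (Fin δ → Fin γ′) →
        MSub Σ θ₁ δ θ₂ → Tm Σ θ₂ γ → Tm Σ θ₁ γ′
instˢ : (Fin γ → Fin γ′) → (Fin δ → Fin γ′) →
        MSub Σ θ₁ δ θ₂ → ∀ {n} → Sub Σ θ₂ γ n → Sub Σ θ₁ γ′ n
instᴹ : (Fin γ → Fin γ′) → (Fin δ → Fin γ′) →
        MSub Σ θ₁ δ θ₂ → MSub Σ θ₂ γ ξ → MSub Σ θ₁ γ′ ξ

inst ρ κ v (var x)     = var (ρ x)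
inst ρ κ v (mvar x ts) = lookup v x [ instˢ ρ κ v ts Vec.++ tabulate (var ∘ κ) ]
inst ρ κ v (op o ts)   = op o (instᴹ ρ κ v ts)

instˢ ρ κ v []       = []
instˢ ρ κ v (t ∷ ts) = inst ρ κ v t ∷ instˢ ρ κ v ts

instᴹ ρ κ v []                   = []
instᴹ ρ κ v (_∷_ {x = n} t ts) =
  inst (lift n ρ) ((n ↑ʳ_) ∘ κ) v t ∷ instᴹ ρ κ v ts

infixl 20 _⟦_⟧ _⟦_⟧ᴹ

_⟦_⟧ : Tm Σ θ₂ γ → MSub Σ θ₁ δ θ₂ → Tm Σ θ₁ (γ + δ)
_⟦_⟧ {γ = γ} {δ = δ} t v = inst (_↑ˡ δ) (γ ↑ʳ_) v t

_⟦_⟧ᴹ : MSub Σ θ₂ γ ξ → MSub Σ θ₁ δ θ₂ → MSub Σ θ₁ (γ + δ) ξ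
_⟦_⟧ᴹ {γ = γ} {δ = δ} ts v = instᴹ (_↑ˡ δ) (γ ↑ʳ_) v ts

------------------------------------------------------------------------
-- Contexts, indexed by their underlying scopes

infixl 5 _▹_ _▹_∶_

data Ctx (Σ : Sig) (θ : MScope) : Scope → Set where
  []  : Ctx Σ θ 0
  _▹_ : Ctx Σ θ γ → Tm Σ θ γ → Ctx Σ θ (suc γ)

data MCtx (Σ : Sig) : MScope → Set where
  []    : MCtx Σ []
  _▹_∶_ : MCtx Σ ξ → Ctx Σ ξ δ → Tm Σ ξ δ → MCtx Σ (δ ∷ ξ)

-- MTel Σ θ ξ: metavariable contexts over θ.  MCtx is kept separate from
-- MTel at θ = [] because ξ ++ [] is not definitionally ξ.
data MTel (Σ : Sig) (θ : MScope) : MScope → Set where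
  []    : MTel Σ θ []
  _▹_∶_ : MTel Σ θ ξ → Ctx Σ (ξ ++ θ) δ → Tm Σ (ξ ++ θ) δ → MTel Σ θ (δ ∷ ξ)

renCtx : Σ ⊆ Σ′ → θ ⊆ θ′ → Ctx Σ θ γ → Ctx Σ′ θ′ γ
renCtx σ μ []      = []
renCtx σ μ (Γ ▹ T) = renCtx σ μ Γ ▹ ren σ μ id T

renMCtx : Σ ⊆ Σ′ → MCtx Σ ξ → MCtx Σ′ ξ
renMCtx σ []          = []
renMCtx σ (Ξ ▹ Δ ∶ T) = renMCtx σ Ξ ▹ renCtx σ id Δ ∶ ren σ id id T

renMTel : Σ ⊆ Σ′ → MTel Σ θ ξ → MTel Σ′ θ ξ
renMTel σ []          = []
renMTel σ (Ξ ▹ Δ ∶ T) = renMTel σ Ξ ▹ renCtx σ id Δ ∶ ren σ id id T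

-- A closed metavariable context, weakened to one over θ.
weaken : MCtx Σ ξ → MTel Σ θ ξ
weaken []          = []
weaken (Ξ ▹ Δ ∶ T) = weaken Ξ ▹ renCtx id ∈-++⁺ˡ Δ ∶ ren id ∈-++⁺ˡ id T

infixl 4 _⧺_

_⧺_ : MCtx Σ θ → MTel Σ θ ξ → MCtx Σ (ξ ++ θ)
Θ ⧺ []          = Θ
Θ ⧺ (Ξ ▹ Δ ∶ T) = (Θ ⧺ Ξ) ▹ Δ ∶ T

-- Γ ▸ Δ ⟪ 𝐭 ⟫ is Γ.Δ[𝐭].
infixl 5 _▸_⟪_⟫

_▸_⟪_⟫ : Ctx Σ θ₁ γ → Ctx Σ θ₂ δ → MSub Σ θ₁ γ θ₂ → Ctx Σ θ₁ (δ + γ)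
Γ ▸ []      ⟪ v ⟫ = Γ
Γ ▸ (Δ ▹ T) ⟪ v ⟫ = (Γ ▸ Δ ⟪ v ⟫) ▹ (T ⟦ v ⟧)

ctxLookup : Ctx Σ θ γ → Fin γ → Tm Σ θ γ
ctxLookup (Γ ▹ T) zero    = wk 1 T
ctxLookup (Γ ▹ T) (suc x) = wk 1 (ctxLookup Γ x)

mctxLookup : MCtx Σ θ → δ ∈ θ → Ctx Σ θ δ × Tm Σ θ δ
mctxLookup (Θ ▹ Δ ∶ T) (here refl) = renCtx id there Δ , ren id there id T
mctxLookup (Θ ▹ _ ∶ _) (there x)   = let Δ , T = mctxLookup Θ x in
  renCtx id there Δ , ren id there id T

------------------------------------------------------------------------
-- Patterns

data TmP (Σ : Sig) : MScope → Scope → Set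
data MSubP (Σ : Sig) : MScope → Scope → MScope → Set

data TmP Σ where
  meta : TmP Σ (γ ∷ []) γ
  con  : con ξ ∈ Σ → MSubP Σ θ γ ξ → TmP Σ θ γ

data MSubP Σ where
  []  : MSubP Σ [] γ []
  _∷_ : TmP Σ θ₂ (δ + γ) → MSubP Σ θ₁ γ ξ → MSubP Σ (θ₂ ++ θ₁) γ (δ ∷ ξ)

⌊_⌋  : TmP Σ θ γ → Tm Σ θ γ
⌊_⌋ᴹ : MSubP Σ θ γ ξ → MSub Σ θ γ ξ

⌊ meta ⌋     = mvar (here refl) idˢ
⌊ con c ts ⌋ = op c ⌊ ts ⌋ᴹ

⌊ [] ⌋ᴹ                = []
⌊ _∷_ {θ₂ = θ₂} t ts ⌋ᴹ = ren id ∈-++⁺ˡ id ⌊ t ⌋ ∷ renᴹ id (∈-++⁺ʳ θ₂) id ⌊ ts ⌋ᴹ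

renP  : Σ ⊆ Σ′ → TmP Σ θ γ → TmP Σ′ θ γ
renPᴹ : Σ ⊆ Σ′ → MSubP Σ θ γ ξ → MSubP Σ′ θ γ ξ

renP σ meta       = meta
renP σ (con c ts) = con (σ c) (renPᴹ σ ts)

renPᴹ σ []       = []
renPᴹ σ (t ∷ ts) = renP σ t ∷ renPᴹ σ ts

------------------------------------------------------------------------
-- Theories

-- Rules declaring a symbol, indexed by the declared signature entry.
--   sort Ξ              is  c(Ξ) sort
--   cons Ξp Ξc Ξi vi T  is  c(Ξp; Ξc; vi/Ξi) : T
--   dest Ξpi T Ξd U     is  d(Ξpi; 𝚡 : T; Ξd) : U
data SymRule (Σ : Sig) : Op → Set where
  sort : MCtx Σ ξ → SymRule Σ (con ξ)
  cons : MCtx Σ ξp → MTel Σ ξp ξc → MTel Σ ξp ξi →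
         MSub Σ (ξc ++ ξp) 0 ξi → TmP Σ (ξi ++ ξp) 0 → SymRule Σ (con ξc)
  dest : MCtx Σ ξp → TmP Σ ξp 0 → MTel Σ (0 ∷ ξp) ξd →
         Tm Σ (ξd ++ 0 ∷ ξp) 0 → SymRule Σ (des ξd)

renSymRule : Σ ⊆ Σ′ → SymRule Σ o → SymRule Σ′ o
renSymRule σ (sort Ξ) = sort (renMCtx σ Ξ)
renSymRule σ (cons Ξp Ξc Ξi vi T) =
  cons (renMCtx σ Ξp) (renMTel σ Ξc) (renMTel σ Ξi) (renᴹ σ id id vi) (renP σ T)
renSymRule σ (dest Ξpi T Ξd U) =
  dest (renMCtx σ Ξpi) (renP σ T) (renMTel σ Ξd) (ren σ id id U)

infix 4 _⊩_⦅_⦆↦_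

data RewRule (Σ : Sig) : Set where
  _⊩_⦅_⦆↦_ : ∀ θ → des ξ ∈ Σ → MSubP Σ θ 0 (arity (des ξ)) → Tm Σ θ 0 → RewRule Σ

renRewRule : Σ ⊆ Σ′ → RewRule Σ → RewRule Σ′
renRewRule σ (θ ⊩ d ⦅ ts ⦆↦ r) = θ ⊩ σ d ⦅ renPᴹ σ ts ⦆↦ ren σ id id r

-- Each rule is over the signature of the theory it extends; rules and
-- rewriteRules return them weakened to the final signature.  Symbols
-- being positions in the signature, they are pairwise distinct.
data Theory : Sig → Set
rewriteRules : Theory Σ → List (RewRule Σ)

data Theory where
  ∅          : Theory []
  _▹_        : Theory Σ → SymRule Σ o → Theory (o ∷ Σ)
  addRewrite : (𝕋 : Theory Σ) →
    ∀ θ (d : des ξ ∈ Σ) (ts : MSubP Σ θ 0 (arity (des ξ))) (r : Tm Σ θ 0) →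
    (∀ {θ′ ts′ r′} → (θ′ ⊩ d ⦅ ts′ ⦆↦ r′) ∈ rewriteRules 𝕋 →
     ∀ {θ″ δ} (u : MSub Σ θ″ δ θ) (u′ : MSub Σ θ″ δ θ′) →
     ⌊ ts ⌋ᴹ ⟦ u ⟧ᴹ ≢ ⌊ ts′ ⌋ᴹ ⟦ u′ ⟧ᴹ) →
    Theory Σ

rewriteRules ∅                       = []
rewriteRules (𝕋 ▹ _)                 = map (renRewRule there) (rewriteRules 𝕋)
rewriteRules (addRewrite 𝕋 θ d ts r _) = (θ ⊩ d ⦅ ts ⦆↦ r) ∷ rewriteRules 𝕋

rule : Theory Σ → o ∈ Σ → SymRule Σ o
rule (𝕋 ▹ R)                (here refl) = renSymRule there R
rule (𝕋 ▹ _)                (there x)   = renSymRule there (rule 𝕋 x)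
rule (addRewrite 𝕋 _ _ _ _ _) x         = rule 𝕋 x

------------------------------------------------------------------------
-- Bidirectional syntax

data TmC (Σ : Sig) : Scope → Set
data TmI (Σ : Sig) : Scope → Set

MSubC : Sig → Scope → MScope → Set
MSubC Σ γ ξ = All (λ δ → TmC Σ (δ + γ)) ξ

infix 6 _⦂_

data TmC Σ where
  con       : con ξ ∈ Σ → MSubC Σ γ ξ → TmC Σ γ
  underline : TmI Σ γ → TmC Σ γ

data TmI Σ where
  var : Fin γ → TmI Σ γ
  des : des ξ ∈ Σ → TmI Σ γ → MSubC Σ γ ξ → TmI Σ γ
  _⦂_ : TmC Σ γ → TmC Σ γ → TmI Σ γ

⌜_⌝ᶜ : TmC Σ γ → Tm Σ [] γ
⌜_⌝ⁱ : TmI Σ γ → Tm Σ [] γ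
⌜_⌝ᴹ : MSubC Σ γ ξ → MSub Σ [] γ ξ

⌜ con c ts ⌝ᶜ    = op c ⌜ ts ⌝ᴹ
⌜ underline t ⌝ᶜ = ⌜ t ⌝ⁱ

⌜ var x ⌝ⁱ      = var x
⌜ des d t ts ⌝ⁱ = op d (++⁺ ⌜ ts ⌝ᴹ (⌜ t ⌝ⁱ ∷ []))
⌜ t ⦂ T ⌝ⁱ      = ⌜ t ⌝ᶜ

⌜ [] ⌝ᴹ     = []
⌜ t ∷ ts ⌝ᴹ = ⌜ t ⌝ᶜ ∷ ⌜ ts ⌝ᴹ

data MinimalC {Σ : Sig} {γ : Scope} : TmC Σ γ → Set
data MinimalI {Σ : Sig} {γ : Scope} : TmI Σ γ → Set
data MinimalM {Σ : Sig} {γ : Scope} : MSubC Σ γ ξ → Set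

data MinimalC {Σ} {γ} where
  con       : {c : con ξ ∈ Σ} {ts : MSubC Σ γ ξ} → MinimalM ts → MinimalC (con c ts)
  underline : {t : TmI Σ γ} → (∀ s S → t ≢ (s ⦂ S)) → MinimalI t →
              MinimalC (underline t)

data MinimalI {Σ} {γ} where
  var : {x : Fin γ} → MinimalI (var x)
  des : {d : des ξ ∈ Σ} {t : TmI Σ γ} {ts : MSubC Σ γ ξ} →
        MinimalI t → MinimalM ts → MinimalI (des d t ts)
  asc : {t T : TmC Σ γ} → (∀ s → t ≢ underline s) → MinimalC t → MinimalC T →
        MinimalI (t ⦂ T)

data MinimalM {Σ} {γ} where
  []  : MinimalM []
  _∷_ : {t : TmC Σ (δ + γ)} {ts : MSubC Σ γ ξ} → MinimalC t → MinimalM ts →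
        MinimalM {ξ = δ ∷ ξ} (t ∷ ts)

------------------------------------------------------------------------
-- Rewriting, matching and typing in a theory

module Judgments {Σ : Sig} (𝕋 : Theory Σ) where

  infix 4 _⟶_ _⟶ˢ_ _⟶ᴹ_ _⟶*_ _≈_ _≈ᴹ_

  data _⟶_ {θ γ} : Tm Σ θ γ → Tm Σ θ γ → Set
  data _⟶ˢ_ {θ γ} : Sub Σ θ γ δ → Sub Σ θ γ δ → Set
  data _⟶ᴹ_ {θ γ} : MSub Σ θ γ ξ → MSub Σ θ γ ξ → Set

  data _⟶_ {θ} {γ} where
    root : ∀ {d : des ξ ∈ Σ} {us : MSubP Σ θ₁ 0 (arity (des ξ))} {r} →
           (θ₁ ⊩ d ⦅ us ⦆↦ r) ∈ rewriteRules 𝕋 → (ts : MSub Σ θ γ θ₁) →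
           op d (⌊ us ⌋ᴹ ⟦ ts ⟧ᴹ) ⟶ r ⟦ ts ⟧
    mvar : ∀ {x : δ ∈ θ} {ts ts′} → ts ⟶ˢ ts′ → mvar x ts ⟶ mvar x ts′
    op   : ∀ {x : o ∈ Σ} {ts ts′} → ts ⟶ᴹ ts′ → op x ts ⟶ op x ts′

  data _⟶ˢ_ {θ} {γ} where
    here  : ∀ {t t′} {ts : Sub Σ θ γ δ} → t ⟶ t′ → (t ∷ ts) ⟶ˢ (t′ ∷ ts)
    there : ∀ {t} {ts ts′ : Sub Σ θ γ δ} → ts ⟶ˢ ts′ → (t ∷ ts) ⟶ˢ (t ∷ ts′)

  data _⟶ᴹ_ {θ} {γ} where
    here  : ∀ {t t′ : Tm Σ θ (δ + γ)} {ts : MSub Σ θ γ ξ} → t ⟶ t′ →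
            _⟶ᴹ_ {ξ = δ ∷ ξ} (t ∷ ts) (t′ ∷ ts)
    there : ∀ {t : Tm Σ θ (δ + γ)} {ts ts′ : MSub Σ θ γ ξ} → ts ⟶ᴹ ts′ →
            _⟶ᴹ_ {ξ = δ ∷ ξ} (t ∷ ts) (t ∷ ts′)

  _⟶*_ : Tm Σ θ γ → Tm Σ θ γ → Set
  _⟶*_ = Star _⟶_

  _≈_ : Tm Σ θ γ → Tm Σ θ γ → Set
  _≈_ = EqClosure _⟶_

  _≈ᴹ_ : MSub Σ θ γ ξ → MSub Σ θ γ ξ → Set
  _≈ᴹ_ = EqClosure _⟶ᴹ_

  -- The matched expression lives in δ.γ, with γ the scope of the
  -- pattern; under binders δ′ it has to be moved from (δ.γ).δ′ to
  -- δ.(γ.δ′).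
  infix 4 _≺_↝_ _≺ᴹ_↝_

  data _≺_↝_ {δ} : TmP Σ θ γ → Tm Σ [] (γ + δ) → MSub Σ [] δ θ → Set
  data _≺ᴹ_↝_ {δ} : MSubP Σ θ γ ξ → MSub Σ [] (γ + δ) ξ → MSub Σ [] δ θ → Set

  data _≺_↝_ {δ} where
    con  : ∀ {c : con ξ ∈ Σ} {ts : MSubP Σ θ γ ξ} {u us v} →
           u ⟶* op c us → ts ≺ᴹ us ↝ v → con c ts ≺ u ↝ v
    meta : ∀ {u : Tm Σ [] (γ + δ)} → meta ≺ u ↝ (u ∷ [])

  data _≺ᴹ_↝_ {δ} where
    []  : _≺ᴹ_↝_ {γ = γ} [] [] []
    _∷_ : ∀ {δ′} {t : TmP Σ θ₂ (δ′ + γ)} {ts : MSubP Σ θ₁ γ ξ} {u us v₁ v₂} →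
          t ≺ subst (Tm Σ []) (sym (+-assoc δ′ γ δ)) u ↝ v₂ → ts ≺ᴹ us ↝ v₁ →
          (t ∷ ts) ≺ᴹ (u ∷ us) ↝ ++⁺ v₂ v₁

  -- Declarative typing.

  infix 3 ⊢_ _⨾_⊢ _⨾_⊢_sort _⨾_⊢_∶_ _⨾_⊢ˢ_∶_ _⨾_⊢ᴹ_∶_

  data ⊢_ : MCtx Σ θ → Set
  data _⨾_⊢ (Θ : MCtx Σ θ) : Ctx Σ θ γ → Set
  data _⨾_⊢_sort (Θ : MCtx Σ θ) (Γ : Ctx Σ θ γ) : Tm Σ θ γ → Set
  data _⨾_⊢_∶_ (Θ : MCtx Σ θ) (Γ : Ctx Σ θ γ) : Tm Σ θ γ → Tm Σ θ γ → Set
  data _⨾_⊢ˢ_∶_ (Θ : MCtx Σ θ) (Γ : Ctx Σ θ γ) : Sub Σ θ γ δ → Ctx Σ θ δ → Set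
  data _⨾_⊢ᴹ_∶_ (Θ : MCtx Σ θ) (Γ : Ctx Σ θ γ) : MSub Σ θ γ ξ → MCtx Σ ξ → Set

  data ⊢_ where
    []  : ⊢ []
    ext : ∀ {Θ : MCtx Σ θ} {Γ : Ctx Σ θ γ} {T} →
          Θ ⨾ Γ ⊢ T sort → ⊢ (Θ ▹ Γ ∶ T)

  data _⨾_⊢ {θ} Θ where
    []  : ⊢ Θ → Θ ⨾ [] ⊢
    ext : ∀ {Γ : Ctx Σ θ γ} {T} → Θ ⨾ Γ ⊢ T sort → Θ ⨾ (Γ ▹ T) ⊢

  data _⨾_⊢_sort {θ} {γ} Θ Γ where
    Sort : ∀ {c : con ξ ∈ Σ} {Ξ ts} → rule 𝕋 c ≡ sort Ξ →
           Θ ⨾ Γ ⊢ᴹ ts ∶ Ξ →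
           Θ ⨾ Γ ⊢ op c ts sort

  data _⨾_⊢_∶_ {θ} {γ} Θ Γ where
    Var  : ∀ x → Θ ⨾ Γ ⊢ → Θ ⨾ Γ ⊢ var x ∶ ctxLookup Γ x
    MVar : ∀ (x : δ ∈ θ) {ts} →
           Θ ⨾ Γ ⊢ˢ ts ∶ proj₁ (mctxLookup Θ x) →
           Θ ⨾ Γ ⊢ mvar x ts ∶ proj₂ (mctxLookup Θ x) [ ts ]
    Cons : ∀ {c : con ξc ∈ Σ} {Ξp : MCtx Σ ξp} {Ξc} {Ξi : MTel Σ ξp ξi} {vi T}
             {tp : MSub Σ θ γ ξp} {ts : MSub Σ θ γ ξc} →
           rule 𝕋 c ≡ cons Ξp Ξc Ξi vi T →
           Θ ⨾ Γ ⊢ᴹ ++⁺ ts tp ∶ (Ξp ⧺ Ξc) →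
           Θ ⨾ Γ ⊢ ⌊ T ⌋ ⟦ ++⁺ (vi ⟦ ++⁺ ts tp ⟧ᴹ) tp ⟧ sort →
           Θ ⨾ Γ ⊢ op c ts ∶ ⌊ T ⌋ ⟦ ++⁺ (vi ⟦ ++⁺ ts tp ⟧ᴹ) tp ⟧
    Dest : ∀ {d : des ξd ∈ Σ} {Ξpi : MCtx Σ ξp} {T Ξd U}
             {tpi : MSub Σ θ γ ξp} {t : Tm Σ θ γ} {ts : MSub Σ θ γ ξd} →
           rule 𝕋 d ≡ dest Ξpi T Ξd U →
           Θ ⨾ Γ ⊢ᴹ ++⁺ ts (t ∷ tpi) ∶ ((Ξpi ▹ [] ∶ ⌊ T ⌋) ⧺ Ξd) →
           Θ ⨾ Γ ⊢ op d (++⁺ ts (t ∷ [])) ∶ U ⟦ ++⁺ ts (t ∷ tpi) ⟧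
    Conv : ∀ {t T U} → Θ ⨾ Γ ⊢ t ∶ T → T ≈ U → Θ ⨾ Γ ⊢ U sort →
           Θ ⨾ Γ ⊢ t ∶ U

  data _⨾_⊢ˢ_∶_ {θ} {γ} Θ Γ where
    []  : Θ ⨾ Γ ⊢ → Θ ⨾ Γ ⊢ˢ [] ∶ []
    ext : ∀ {ts : Sub Σ θ γ δ} {Δ t T} →
          Θ ⨾ Γ ⊢ˢ ts ∶ Δ → Θ ⨾ Γ ⊢ t ∶ T [ ts ] →
          Θ ⨾ Γ ⊢ˢ (t ∷ ts) ∶ (Δ ▹ T)

  data _⨾_⊢ᴹ_∶_ {θ} {γ} Θ Γ where
    []  : Θ ⨾ Γ ⊢ → Θ ⨾ Γ ⊢ᴹ [] ∶ []
    ext : ∀ {ts : MSub Σ θ γ ξ} {Ξ} {Δ : Ctx Σ ξ δ} {t T} →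
          Θ ⨾ Γ ⊢ᴹ ts ∶ Ξ → Θ ⨾ (Γ ▸ Δ ⟪ ts ⟫) ⊢ t ∶ T ⟦ ts ⟧ →
          Θ ⨾ Γ ⊢ᴹ (t ∷ ts) ∶ (Ξ ▹ Δ ∶ T)

  -- Bidirectional typing.

  infix 3 _⊢_⇐sort _⊢_⇐_ _⊢_⇒_ _∣_∶_⊢_⇐_

  data _⊢_⇐sort (Γ : Ctx Σ [] γ) : TmC Σ γ → Set
  data _⊢_⇐_ (Γ : Ctx Σ [] γ) : TmC Σ γ → Tm Σ [] γ → Set
  data _⊢_⇒_ (Γ : Ctx Σ [] γ) : TmI Σ γ → Tm Σ [] γ → Set
  data _∣_∶_⊢_⇐_ (Γ : Ctx Σ [] γ) (v : MSub Σ [] γ θ) (Θ : MCtx Σ θ) :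
                 MSubC Σ γ ξ → MTel Σ θ ξ → Set

  data _⊢_⇐sort {γ} Γ where
    Sort : ∀ {c : con ξ ∈ Σ} {Ξ ts} → rule 𝕋 c ≡ sort Ξ →
           Γ ∣ [] ∶ [] ⊢ ts ⇐ weaken Ξ →
           Γ ⊢ con c ts ⇐sort

  data _⊢_⇐_ {γ} Γ where
    Cons   : ∀ {c : con ξc ∈ Σ} {Ξp : MCtx Σ ξp} {Ξc} {Ξi : MTel Σ ξp ξi} {vi T}
               {T′} {tp : MSub Σ [] γ ξp} {ti : MSub Σ [] γ ξi} {us : MSubC Σ γ ξc} →
             rule 𝕋 c ≡ cons Ξp Ξc Ξi vi T →
             T ≺ T′ ↝ ++⁺ ti tp →
             Γ ∣ tp ∶ Ξp ⊢ us ⇐ Ξc →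
             ti ≈ᴹ vi ⟦ ++⁺ ⌜ us ⌝ᴹ tp ⟧ᴹ →
             Γ ⊢ con c us ⇐ T′
    Switch : ∀ {t T U} → Γ ⊢ t ⇒ T → T ≈ U → Γ ⊢ underline t ⇐ U

  data _⊢_⇒_ {γ} Γ where
    Var   : ∀ x → Γ ⊢ var x ⇒ ctxLookup Γ x
    Annot : ∀ {t T} → Γ ⊢ T ⇐sort → Γ ⊢ t ⇐ ⌜ T ⌝ᶜ → Γ ⊢ t ⦂ T ⇒ ⌜ T ⌝ᶜ
    Dest  : ∀ {d : des ξd ∈ Σ} {Ξpi : MCtx Σ ξp} {T Ξd U}
              {t T′} {tpi : MSub Σ [] γ ξp} {us : MSubC Σ γ ξd} →
            rule 𝕋 d ≡ dest Ξpi T Ξd U →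
            Γ ⊢ t ⇒ T′ →
            T ≺ T′ ↝ tpi →
            Γ ∣ (⌜ t ⌝ⁱ ∷ tpi) ∶ (Ξpi ▹ [] ∶ ⌊ T ⌋) ⊢ us ⇐ Ξd →
            Γ ⊢ des d t us ⇒ U ⟦ ++⁺ ⌜ us ⌝ᴹ (⌜ t ⌝ⁱ ∷ tpi) ⟧

  data _∣_∶_⊢_⇐_ {γ} {θ} Γ v Θ where
    EmptyMSub : Γ ∣ v ∶ Θ ⊢ [] ⇐ []
    ExtMSub   : ∀ {ts : MSubC Σ γ ξ} {Ξ} {Δ : Ctx Σ (ξ ++ θ) δ} {t T} →
                Γ ∣ v ∶ Θ ⊢ ts ⇐ Ξ →
                (Γ ▸ Δ ⟪ ++⁺ ⌜ ts ⌝ᴹ v ⟫) ⊢ t ⇐ T ⟦ ++⁺ ⌜ ts ⌝ᴹ v ⟧ →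
                Γ ∣ v ∶ Θ ⊢ (t ∷ ts) ⇐ (Ξ ▹ Δ ∶ T)

{-# OPTIONS --safe #-}
module Submission where

-- Rewriting is orthogonal: left-hand sides are linear, have constructor
-- patterns below a single destructor, and distinct rules do not unify.  Hence
-- parallel reduction has the diamond property, and matching a pattern is
-- complete and stable under convertibility: if p ≺ t ↝ v and t ≈ u then
-- p ≺ u ↝ w with v ≈ᴹ w.  So the bidirectional judgments are stable under
-- conversion of the context, the type and the metavariable substitution.
-- A declarative derivation is then annotated by recursion: conversions are
-- absorbed by this stability, the arguments erased from a constructor or
-- destructor are recovered by matching, and a constructor in inferable
-- position is ascribed with the sort carried by the Cons rule.

open import Defs
open import Data.Empty using (⊥-elim)
open import Data.Fin using (Fin; zero; suc; toℕ; splitAt; _↑ˡ_; _↑ʳ_)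
open import Data.Fin.Properties
  using (splitAt-↑ˡ; splitAt-↑ʳ; join-splitAt; toℕ-↑ˡ; toℕ-↑ʳ; toℕ-injective)
open import Data.List using (List; []; _∷_; _++_)
open import Data.List.Membership.Propositional using (_∈_)
open import Data.List.Membership.Propositional.Properties using (∈-++⁺ˡ; ∈-++⁺ʳ; ∈-map⁻)
open import Data.List.Relation.Binary.Subset.Propositional using (_⊆_)
import Data.List.Relation.Unary.All as All
open import Data.List.Relation.Unary.All using (All; []; _∷_; lookup)
open import Data.List.Relation.Unary.All.Properties using (++⁺; ++⁻ˡ; ++⁻ʳ)
open import Data.List.Relation.Unary.Any using (here; there)
open import Data.Nat using (zero; suc; _+_)
open import Data.Nat.Properties using (+-assoc)
open import Data.Product using (_×_; _,_; ∃-syntax)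
open import Data.Sum using (inj₁; inj₂)
open import Data.Vec using (Vec; []; _∷_; tabulate)
import Data.Vec as Vec
open import Data.Vec.Properties
  using (lookup-++ˡ; lookup-++ʳ; lookup∘tabulate; tabulate∘lookup; lookup-map;
         tabulate-∘; tabulate-cong)
open import Function using (id; _∘_)
import Relation.Binary.Construct.Closure.Equivalence as Eq
open import Relation.Binary.Construct.Closure.ReflexiveTransitive as Star
  using (Star; ε; _◅_; _◅◅_)
open import Relation.Binary.Construct.Closure.Symmetric using (fwd; bwd)
open import Relation.Binary.PropositionalEquality
  using (_≡_; refl; sym; trans; cong; cong₂; subst; subst₂; module ≡-Reasoning)

-- Variables of concatenated scopes, lookup in substitutions

private variable
  γ₁ γ₂ γ₃ : Scope

-- `lift` and `liftˢ` are defined through `splitAt`; pointwise equations about them reduce by this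
-- case split to the computation on the two injections.
↑-elim : ∀ m {n} (P : Fin (m + n) → Set) →
         (∀ i → P (i ↑ˡ n)) → (∀ j → P (m ↑ʳ j)) → ∀ i → P i
↑-elim m {n} P l r i with splitAt m i | join-splitAt m n i
... | inj₁ j | eq = subst P eq (l j)
... | inj₂ j | eq = subst P eq (r j)

tabulate-++ : ∀ {A : Set} m {n} (f : Fin (m + n) → A) →
              tabulate (f ∘ (_↑ˡ n)) Vec.++ tabulate (f ∘ (m ↑ʳ_)) ≡ tabulate f
tabulate-++ zero    f = refl
tabulate-++ (suc m) f = cong (f zero ∷_) (tabulate-++ m (f ∘ suc))

lift-↑ˡ : ∀ n (ρ : Fin γ → Fin γ′) i → lift n ρ (i ↑ˡ γ) ≡ i ↑ˡ γ′
lift-↑ˡ {γ = γ} n ρ i rewrite splitAt-↑ˡ n i γ = refl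

lift-↑ʳ : ∀ n (ρ : Fin γ → Fin γ′) i → lift n ρ (n ↑ʳ i) ≡ n ↑ʳ ρ i
lift-↑ʳ {γ = γ} n ρ i rewrite splitAt-↑ʳ n γ i = refl

lookup-liftˢ-↑ˡ : ∀ n (s : Sub Σ θ γ′ γ) i →
                  Vec.lookup (liftˢ n s) (i ↑ˡ γ) ≡ var (i ↑ˡ γ′)
lookup-liftˢ-↑ˡ n s i =
  trans (lookup-++ˡ (tabulate _) _ i) (lookup∘tabulate _ i)

lookup-liftˢ-↑ʳ : ∀ n (s : Sub Σ θ γ′ γ) i →
                  Vec.lookup (liftˢ n s) (n ↑ʳ i) ≡ wk n (Vec.lookup s i)
lookup-liftˢ-↑ʳ {γ′ = γ′} n s i =
  trans (lookup-++ʳ (tabulate {n = n} λ i → var (i ↑ˡ γ′)) _ i) (lookup-map i _ s)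

-- The traversals of `Sub` are spelled out by mutual recursion with those of terms; as instances of
-- `Vec.map` they admit the library lemmas on lookup.
renˢ-map : (ρ : Fin γ → Fin γ′) (ts : Sub Σ θ γ δ) →
           renˢ id id ρ ts ≡ Vec.map (ren id id ρ) ts
renˢ-map ρ []       = refl
renˢ-map ρ (t ∷ ts) = cong (_ ∷_) (renˢ-map ρ ts)

[]ˢ-map : (ts : Sub Σ θ γ δ) (s : Sub Σ θ γ′ γ) → ts [ s ]ˢ ≡ Vec.map (_[ s ]) ts
[]ˢ-map []       s = refl
[]ˢ-map (t ∷ ts) s = cong (_ ∷_) ([]ˢ-map ts s)

instˢ-map : (ρ : Fin γ → Fin γ′) (κ : Fin δ → Fin γ′) (v : MSub Σ θ₁ δ θ₂) →
            ∀ {n} (ts : Sub Σ θ₂ γ n) → instˢ ρ κ v ts ≡ Vec.map (inst ρ κ v) ts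
instˢ-map ρ κ v []       = refl
instˢ-map ρ κ v (t ∷ ts) = cong (_ ∷_) (instˢ-map ρ κ v ts)

[]ˢ-++ : ∀ {m n} (ts : Sub Σ θ γ m) (us : Sub Σ θ γ n) (s : Sub Σ θ γ′ γ) →
         (ts Vec.++ us) [ s ]ˢ ≡ ts [ s ]ˢ Vec.++ us [ s ]ˢ
[]ˢ-++ []       us s = refl
[]ˢ-++ (t ∷ ts) us s = cong (_ ∷_) ([]ˢ-++ ts us s)

lookup-[]ˢ : (ts : Sub Σ θ γ δ) (s : Sub Σ θ γ′ γ) → ∀ i →
             Vec.lookup (ts [ s ]ˢ) i ≡ Vec.lookup ts i [ s ]
lookup-[]ˢ ts s i = trans (cong (λ us → Vec.lookup us i) ([]ˢ-map ts s)) (lookup-map i _ ts)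

lookup-renˢ : (ρ : Fin γ → Fin γ′) (ts : Sub Σ θ γ δ) → ∀ i →
              Vec.lookup (renˢ id id ρ ts) i ≡ ren id id ρ (Vec.lookup ts i)
lookup-renˢ ρ ts i = trans (cong (λ us → Vec.lookup us i) (renˢ-map ρ ts)) (lookup-map i _ ts)

lookup-ext : ∀ {A : Set} {n} {xs ys : Vec A n} →
             (∀ i → Vec.lookup xs i ≡ Vec.lookup ys i) → xs ≡ ys
lookup-ext {xs = xs} {ys} eq =
  trans (sym (tabulate∘lookup xs)) (trans (tabulate-cong eq) (tabulate∘lookup ys))

lookup-[]ᴹ : (v : MSub Σ θ γ ξ) (s : Sub Σ θ γ′ γ) (x : δ ∈ ξ) →
             lookup (v [ s ]ᴹ) x ≡ lookup v x [ liftˢ δ s ]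
lookup-[]ᴹ (t ∷ v) s (here refl) = refl
lookup-[]ᴹ (t ∷ v) s (there x)   = lookup-[]ᴹ v s x

-- Renaming

lift-id : ∀ n {ρ : Fin γ → Fin γ} → (∀ i → ρ i ≡ i) → ∀ i → lift n ρ i ≡ i
lift-id n {ρ} eq = ↑-elim n _ (lift-↑ˡ n ρ) λ i → trans (lift-↑ʳ n ρ i) (cong (n ↑ʳ_) (eq i))

-- Stated for a renaming pointwise equal to the identity, because `lift n id` is `id` only
-- pointwise. The fusion lemmas below take the composite as a parameter with a pointwise equation
-- for the same reason.
ren-id  : ∀ {ρ : Fin γ → Fin γ} → (∀ i → ρ i ≡ i) → (t : Tm Σ θ γ) → ren id id ρ t ≡ t
renˢ-id : ∀ {ρ : Fin γ → Fin γ} → (∀ i → ρ i ≡ i) → (ts : Sub Σ θ γ δ) → renˢ id id ρ ts ≡ ts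
renᴹ-id : ∀ {ρ : Fin γ → Fin γ} → (∀ i → ρ i ≡ i) → (ts : MSub Σ θ γ ξ) → renᴹ id id ρ ts ≡ ts
ren-id eq (var x)     = cong var (eq x)
ren-id eq (mvar x ts) = cong (mvar x) (renˢ-id eq ts)
ren-id eq (op o ts)   = cong (op o) (renᴹ-id eq ts)
renˢ-id eq []       = refl
renˢ-id eq (t ∷ ts) = cong₂ _∷_ (ren-id eq t) (renˢ-id eq ts)
renᴹ-id eq [] = refl
renᴹ-id eq (_∷_ {x = n} t ts) = cong₂ _∷_ (ren-id (lift-id n eq) t) (renᴹ-id eq ts)

lift-lift : ∀ n {ρ : Fin γ₁ → Fin γ₂} {ρ′ : Fin γ₂ → Fin γ₃} {ρ″} →
            (∀ i → ρ′ (ρ i) ≡ ρ″ i) → ∀ i → lift n ρ′ (lift n ρ i) ≡ lift n ρ″ i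
lift-lift n {ρ = ρ} {ρ′} {ρ″} eq = ↑-elim n _
  (λ i → trans (cong (lift n ρ′) (lift-↑ˡ n ρ i))
               (trans (lift-↑ˡ n ρ′ i) (sym (lift-↑ˡ n ρ″ i))))
  (λ i → trans (cong (lift n ρ′) (lift-↑ʳ n ρ i))
               (trans (lift-↑ʳ n ρ′ (ρ i))
                      (trans (cong (n ↑ʳ_) (eq i)) (sym (lift-↑ʳ n ρ″ i)))))

ren-ren  : {ρ : Fin γ₁ → Fin γ₂} {ρ′ : Fin γ₂ → Fin γ₃} {ρ″ : Fin γ₁ → Fin γ₃} →
          (∀ i → ρ′ (ρ i) ≡ ρ″ i) → (t : Tm Σ θ γ₁) →
          ren id id ρ′ (ren id id ρ t) ≡ ren id id ρ″ t
renˢ-renˢ : {ρ : Fin γ₁ → Fin γ₂} {ρ′ : Fin γ₂ → Fin γ₃} {ρ″ : Fin γ₁ → Fin γ₃} →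
          (∀ i → ρ′ (ρ i) ≡ ρ″ i) → (ts : Sub Σ θ γ₁ δ) →
          renˢ id id ρ′ (renˢ id id ρ ts) ≡ renˢ id id ρ″ ts
renᴹ-renᴹ : {ρ : Fin γ₁ → Fin γ₂} {ρ′ : Fin γ₂ → Fin γ₃} {ρ″ : Fin γ₁ → Fin γ₃} →
          (∀ i → ρ′ (ρ i) ≡ ρ″ i) → (ts : MSub Σ θ γ₁ ξ) →
          renᴹ id id ρ′ (renᴹ id id ρ ts) ≡ renᴹ id id ρ″ ts
ren-ren eq (var x)     = cong var (eq x)
ren-ren eq (mvar x ts) = cong (mvar x) (renˢ-renˢ eq ts)
ren-ren eq (op o ts)   = cong (op o) (renᴹ-renᴹ eq ts)
renˢ-renˢ eq []       = refl
renˢ-renˢ eq (t ∷ ts) = cong₂ _∷_ (ren-ren eq t) (renˢ-renˢ eq ts)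
renᴹ-renᴹ eq [] = refl
renᴹ-renᴹ eq (_∷_ {x = n} t ts) = cong₂ _∷_ (ren-ren (lift-lift n eq) t) (renᴹ-renᴹ eq ts)

-- Both sides are the single renaming that sends `i` to `n ↑ʳ ρ i`.
wk-ren : ∀ n (ρ : Fin γ → Fin γ′) (t : Tm Σ θ γ) →
         wk n (ren id id ρ t) ≡ ren id id (lift n ρ) (wk n t)
wk-ren n ρ t = trans (ren-ren (λ _ → refl) t) (sym (ren-ren (lift-↑ʳ n ρ) t))

-- Substitution

liftˢ-ren : ∀ n {ρ : Fin γ₁ → Fin γ₂} {s : Sub Σ θ γ₃ γ₂} {s′ : Sub Σ θ γ₃ γ₁} →
            (∀ i → Vec.lookup s (ρ i) ≡ Vec.lookup s′ i) →
            ∀ i → Vec.lookup (liftˢ n s) (lift n ρ i) ≡ Vec.lookup (liftˢ n s′) i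
liftˢ-ren n {ρ} {s} {s′} eq = ↑-elim n _
  (λ i → trans (cong (Vec.lookup (liftˢ n s)) (lift-↑ˡ n ρ i))
         (trans (lookup-liftˢ-↑ˡ n s i) (sym (lookup-liftˢ-↑ˡ n s′ i))))
  (λ i → trans (cong (Vec.lookup (liftˢ n s)) (lift-↑ʳ n ρ i))
         (trans (lookup-liftˢ-↑ʳ n s (ρ i))
         (trans (cong (wk n) (eq i)) (sym (lookup-liftˢ-↑ʳ n s′ i)))))

ren-[]  : {ρ : Fin γ₁ → Fin γ₂} {s : Sub Σ θ γ₃ γ₂} {s′ : Sub Σ θ γ₃ γ₁} →
          (∀ i → Vec.lookup s (ρ i) ≡ Vec.lookup s′ i) →
          (t : Tm Σ θ γ₁) → ren id id ρ t [ s ] ≡ t [ s′ ]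
renˢ-[] : {ρ : Fin γ₁ → Fin γ₂} {s : Sub Σ θ γ₃ γ₂} {s′ : Sub Σ θ γ₃ γ₁} →
          (∀ i → Vec.lookup s (ρ i) ≡ Vec.lookup s′ i) →
          (ts : Sub Σ θ γ₁ δ) → renˢ id id ρ ts [ s ]ˢ ≡ ts [ s′ ]ˢ
renᴹ-[] : {ρ : Fin γ₁ → Fin γ₂} {s : Sub Σ θ γ₃ γ₂} {s′ : Sub Σ θ γ₃ γ₁} →
          (∀ i → Vec.lookup s (ρ i) ≡ Vec.lookup s′ i) →
          (ts : MSub Σ θ γ₁ ξ) → renᴹ id id ρ ts [ s ]ᴹ ≡ ts [ s′ ]ᴹ
ren-[] eq (var x)     = eq x
ren-[] eq (mvar x ts) = cong (mvar x) (renˢ-[] eq ts)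
ren-[] eq (op o ts)   = cong (op o) (renᴹ-[] eq ts)
renˢ-[] eq []       = refl
renˢ-[] eq (t ∷ ts) = cong₂ _∷_ (ren-[] eq t) (renˢ-[] eq ts)
renᴹ-[] eq [] = refl
renᴹ-[] eq (_∷_ {x = n} t ts) = cong₂ _∷_ (ren-[] (liftˢ-ren n eq) t) (renᴹ-[] eq ts)

renˢ-liftˢ : ∀ n (ρ : Fin γ₂ → Fin γ₃) (s : Sub Σ θ γ₂ γ₁) →
             renˢ id id (lift n ρ) (liftˢ n s) ≡ liftˢ n (renˢ id id ρ s)
renˢ-liftˢ n ρ s = lookup-ext (↑-elim n _
  (λ i → trans (lookup-renˢ _ (liftˢ n s) _)
         (trans (cong (ren id id (lift n ρ)) (lookup-liftˢ-↑ˡ n s i))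
         (trans (cong var (lift-↑ˡ n ρ i)) (sym (lookup-liftˢ-↑ˡ n (renˢ id id ρ s) i)))))
  (λ i → trans (lookup-renˢ _ (liftˢ n s) _)
         (trans (cong (ren id id (lift n ρ)) (lookup-liftˢ-↑ʳ n s i))
         (trans (sym (wk-ren n ρ _))
         (trans (cong (wk n) (sym (lookup-renˢ ρ s i)))
                (sym (lookup-liftˢ-↑ʳ n (renˢ id id ρ s) i)))))))

[]-ren  : (ρ : Fin γ₂ → Fin γ₃) (s : Sub Σ θ γ₂ γ₁) (t : Tm Σ θ γ₁) →
          ren id id ρ (t [ s ]) ≡ t [ renˢ id id ρ s ]
[]ˢ-ren : (ρ : Fin γ₂ → Fin γ₃) (s : Sub Σ θ γ₂ γ₁) (ts : Sub Σ θ γ₁ δ) →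
          renˢ id id ρ (ts [ s ]ˢ) ≡ ts [ renˢ id id ρ s ]ˢ
[]ᴹ-ren : (ρ : Fin γ₂ → Fin γ₃) (s : Sub Σ θ γ₂ γ₁) (ts : MSub Σ θ γ₁ ξ) →
          renᴹ id id ρ (ts [ s ]ᴹ) ≡ ts [ renˢ id id ρ s ]ᴹ
[]-ren ρ s (var x)     = sym (lookup-renˢ ρ s x)
[]-ren ρ s (mvar x ts) = cong (mvar x) ([]ˢ-ren ρ s ts)
[]-ren ρ s (op o ts)   = cong (op o) ([]ᴹ-ren ρ s ts)
[]ˢ-ren ρ s []       = refl
[]ˢ-ren ρ s (t ∷ ts) = cong₂ _∷_ ([]-ren ρ s t) ([]ˢ-ren ρ s ts)
[]ᴹ-ren ρ s [] = refl
[]ᴹ-ren ρ s (_∷_ {x = n} t ts) = cong₂ _∷_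
  (trans ([]-ren (lift n ρ) (liftˢ n s) t) (cong (t [_]) (renˢ-liftˢ n ρ s)))
  ([]ᴹ-ren ρ s ts)

wk-[] : ∀ n (s : Sub Σ θ γ₂ γ₁) (t : Tm Σ θ γ₁) → wk n t [ liftˢ n s ] ≡ wk n (t [ s ])
wk-[] n s t = trans
  (ren-[] (λ i → trans (lookup-liftˢ-↑ʳ n s i) (sym (lookup-renˢ _ s i))) t)
  (sym ([]-ren _ s t))

liftˢ-[]ˢ : ∀ n (s : Sub Σ θ γ₂ γ₁) (s′ : Sub Σ θ γ₃ γ₂) →
            liftˢ n s [ liftˢ n s′ ]ˢ ≡ liftˢ n (s [ s′ ]ˢ)
liftˢ-[]ˢ n s s′ = lookup-ext (↑-elim n _
  (λ i → trans (lookup-[]ˢ (liftˢ n s) _ _)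
         (trans (cong (_[ liftˢ n s′ ]) (lookup-liftˢ-↑ˡ n s i))
         (trans (lookup-liftˢ-↑ˡ n s′ i) (sym (lookup-liftˢ-↑ˡ n (s [ s′ ]ˢ) i)))))
  (λ i → trans (lookup-[]ˢ (liftˢ n s) _ _)
         (trans (cong (_[ liftˢ n s′ ]) (lookup-liftˢ-↑ʳ n s i))
         (trans (wk-[] n s′ (Vec.lookup s i))
         (trans (cong (wk n) (sym (lookup-[]ˢ s s′ i)))
                (sym (lookup-liftˢ-↑ʳ n (s [ s′ ]ˢ) i)))))))

-- Under a binder this needs that lifting commutes with composition, hence `wk-[]`, which rests on
-- the two mixed fusions of renaming and substitution; this dictates the order of the fusion lemmas.
[]-[]  : (s : Sub Σ θ γ₂ γ₁) (s′ : Sub Σ θ γ₃ γ₂) (t : Tm Σ θ γ₁) →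
         t [ s ] [ s′ ] ≡ t [ s [ s′ ]ˢ ]
[]ˢ-[] : (s : Sub Σ θ γ₂ γ₁) (s′ : Sub Σ θ γ₃ γ₂) (ts : Sub Σ θ γ₁ δ) →
         ts [ s ]ˢ [ s′ ]ˢ ≡ ts [ s [ s′ ]ˢ ]ˢ
[]ᴹ-[] : (s : Sub Σ θ γ₂ γ₁) (s′ : Sub Σ θ γ₃ γ₂) (ts : MSub Σ θ γ₁ ξ) →
         ts [ s ]ᴹ [ s′ ]ᴹ ≡ ts [ s [ s′ ]ˢ ]ᴹ
[]-[] s s′ (var x)     = sym (lookup-[]ˢ s s′ x)
[]-[] s s′ (mvar x ts) = cong (mvar x) ([]ˢ-[] s s′ ts)
[]-[] s s′ (op o ts)   = cong (op o) ([]ᴹ-[] s s′ ts)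
[]ˢ-[] s s′ []       = refl
[]ˢ-[] s s′ (t ∷ ts) = cong₂ _∷_ ([]-[] s s′ t) ([]ˢ-[] s s′ ts)
[]ᴹ-[] s s′ [] = refl
[]ᴹ-[] s s′ (_∷_ {x = n} t ts) = cong₂ _∷_
  (trans ([]-[] (liftˢ n s) (liftˢ n s′) t) (cong (t [_]) (liftˢ-[]ˢ n s s′)))
  ([]ᴹ-[] s s′ ts)

liftˢ-idˢ : ∀ n → liftˢ n (idˢ {Σ} {θ} {γ}) ≡ idˢ
liftˢ-idˢ {γ = γ₁} n = lookup-ext (↑-elim n _
  (λ i → trans (lookup-liftˢ-↑ˡ n idˢ i) (sym (lookup∘tabulate var (i ↑ˡ γ₁))))
  (λ i → trans (lookup-liftˢ-↑ʳ n idˢ i)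
         (trans (cong (wk n) (lookup∘tabulate var i)) (sym (lookup∘tabulate var (n ↑ʳ i))))))

[]-idˢ  : (t : Tm Σ θ γ₁) → t [ idˢ ] ≡ t
[]ˢ-idˢ : (ts : Sub Σ θ γ₁ δ) → ts [ idˢ ]ˢ ≡ ts
[]ᴹ-idˢ : (ts : MSub Σ θ γ₁ ξ) → ts [ idˢ ]ᴹ ≡ ts
[]-idˢ (var x)     = lookup∘tabulate var x
[]-idˢ (mvar x ts) = cong (mvar x) ([]ˢ-idˢ ts)
[]-idˢ (op o ts)   = cong (op o) ([]ᴹ-idˢ ts)
[]ˢ-idˢ []       = refl
[]ˢ-idˢ (t ∷ ts) = cong₂ _∷_ ([]-idˢ t) ([]ˢ-idˢ ts)
[]ᴹ-idˢ [] = refl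
[]ᴹ-idˢ (_∷_ {x = n} t ts) =
  cong₂ _∷_ (trans (cong (t [_]) (liftˢ-idˢ n)) ([]-idˢ t)) ([]ᴹ-idˢ ts)

-- Lets facts about renaming an instance `t ⟦ v ⟧` be read off from those about substituting in it.
ren-as-[] : (ρ : Fin γ₁ → Fin γ₂) (t : Tm Σ θ γ₁) →
            ren id id ρ t ≡ t [ tabulate (var ∘ ρ) ]
ren-as-[] ρ t = trans (sym ([]-idˢ _))
  (ren-[] (λ i → trans (lookup∘tabulate var (ρ i)) (sym (lookup∘tabulate (var ∘ ρ) i))) t)

renᴹ-as-[] : (ρ : Fin γ₁ → Fin γ₂) (ts : MSub Σ θ γ₁ ξ) →
             renᴹ id id ρ ts ≡ ts [ tabulate (var ∘ ρ) ]ᴹ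
renᴹ-as-[] ρ ts = trans (sym ([]ᴹ-idˢ _))
  (renᴹ-[] (λ i → trans (lookup∘tabulate var (ρ i)) (sym (lookup∘tabulate (var ∘ ρ) i))) ts)

-- Metavariable substitution

-- Relating `v` and `w` only through lookup along `μ` covers both halves of a concatenated
-- metavariable scope, as in the erasure of patterns, and the weakening of closed metavariable
-- contexts.
inst-ren  : ∀ {γ₀} (ρ : Fin γ → Fin γ′) (κ : Fin δ → Fin γ′) {ρ₀ : Fin γ₀ → Fin γ}
            {ρ₁ : Fin γ₀ → Fin γ′} {v : MSub Σ θ δ θ₂} {w : MSub Σ θ δ θ₁} (μ : θ₁ ⊆ θ₂) →
            (∀ {n} (x : n ∈ θ₁) → lookup v (μ x) ≡ lookup w x) → (∀ i → ρ (ρ₀ i) ≡ ρ₁ i) →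
            (t : Tm Σ θ₁ γ₀) → inst ρ κ v (ren id μ ρ₀ t) ≡ inst ρ₁ κ w t
instˢ-ren : ∀ {γ₀} (ρ : Fin γ → Fin γ′) (κ : Fin δ → Fin γ′) {ρ₀ : Fin γ₀ → Fin γ}
            {ρ₁ : Fin γ₀ → Fin γ′} {v : MSub Σ θ δ θ₂} {w : MSub Σ θ δ θ₁} (μ : θ₁ ⊆ θ₂) →
            (∀ {n} (x : n ∈ θ₁) → lookup v (μ x) ≡ lookup w x) → (∀ i → ρ (ρ₀ i) ≡ ρ₁ i) →
            ∀ {n} (ts : Sub Σ θ₁ γ₀ n) → instˢ ρ κ v (renˢ id μ ρ₀ ts) ≡ instˢ ρ₁ κ w ts
instᴹ-ren : ∀ {γ₀} (ρ : Fin γ → Fin γ′) (κ : Fin δ → Fin γ′) {ρ₀ : Fin γ₀ → Fin γ}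
            {ρ₁ : Fin γ₀ → Fin γ′} {v : MSub Σ θ δ θ₂} {w : MSub Σ θ δ θ₁} (μ : θ₁ ⊆ θ₂) →
            (∀ {n} (x : n ∈ θ₁) → lookup v (μ x) ≡ lookup w x) → (∀ i → ρ (ρ₀ i) ≡ ρ₁ i) →
            (ts : MSub Σ θ₁ γ₀ ξ) → instᴹ ρ κ v (renᴹ id μ ρ₀ ts) ≡ instᴹ ρ₁ κ w ts
inst-ren ρ κ μ vw eq (var x)     = cong var (eq x)
inst-ren ρ κ μ vw eq (mvar x ts) =
  cong₂ (λ t us → t [ us Vec.++ tabulate (var ∘ κ) ]) (vw x) (instˢ-ren ρ κ μ vw eq ts)
inst-ren ρ κ μ vw eq (op o ts)   = cong (op o) (instᴹ-ren ρ κ μ vw eq ts)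
instˢ-ren ρ κ μ vw eq []       = refl
instˢ-ren ρ κ μ vw eq (t ∷ ts) = cong₂ _∷_ (inst-ren ρ κ μ vw eq t) (instˢ-ren ρ κ μ vw eq ts)
instᴹ-ren ρ κ μ vw eq [] = refl
instᴹ-ren {Σ = Σ} ρ κ μ vw eq (_∷_ {x = n} t ts) = cong₂ _∷_
  (inst-ren (lift n ρ) ((n ↑ʳ_) ∘ κ) μ vw (lift-lift n eq) t)
  (instᴹ-ren ρ κ μ vw eq ts)

module _ {δ′} {κ′ : Fin δ′ → Fin γ′} {s₀ : Sub Σ θ δ′ δ} where

  -- The heart of the metavariable case of `inst-[]`, with `W` the arguments of the metavariable:
  -- bound variables pick entries of `W` on both sides, and the weakened entries of `s₀` skip `W`.
  liftˢ-++ : ∀ {n} (W : Sub Σ θ γ′ n) →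
             liftˢ n s₀ [ W Vec.++ tabulate (var ∘ κ′) ]ˢ ≡ W Vec.++ renˢ id id κ′ s₀
  liftˢ-++ {n = n} W = lookup-ext (↑-elim n _
    (λ i → trans (lookup-[]ˢ (liftˢ n s₀) _ _)
           (trans (cong (_[ W Vec.++ tabulate (var ∘ κ′) ]) (lookup-liftˢ-↑ˡ n s₀ i))
           (trans (lookup-++ˡ W _ i) (sym (lookup-++ˡ W (renˢ id id κ′ s₀) i)))))
    (λ i → trans (lookup-[]ˢ (liftˢ n s₀) _ _)
           (trans (cong (_[ W Vec.++ tabulate (var ∘ κ′) ]) (lookup-liftˢ-↑ʳ n s₀ i))
           (trans (ren-[] (lookup-++ʳ W (tabulate (var ∘ κ′))) (Vec.lookup s₀ i))
           (trans (sym (ren-as-[] κ′ _))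
           (trans (sym (lookup-renˢ κ′ s₀ i))
                  (sym (lookup-++ʳ W (renˢ id id κ′ s₀) i))))))))

module _ {δ′} {v : MSub Σ θ₁ δ θ₂} {s₀ : Sub Σ θ₁ δ′ δ} where

  liftˢ-ρ : ∀ n {s : Sub Σ θ₁ γ₃ γ′} {ρ : Fin γ → Fin γ′} {ρ′ : Fin γ → Fin γ₃} →
            (∀ i → Vec.lookup s (ρ i) ≡ var (ρ′ i)) →
            ∀ i → Vec.lookup (liftˢ n s) (lift n ρ i) ≡ var (lift n ρ′ i)
  liftˢ-ρ n {s} {ρ} {ρ′} eq = ↑-elim n _
    (λ i → trans (cong (Vec.lookup (liftˢ n s)) (lift-↑ˡ n ρ i))
           (trans (lookup-liftˢ-↑ˡ n s i) (cong var (sym (lift-↑ˡ n ρ′ i)))))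
    (λ i → trans (cong (Vec.lookup (liftˢ n s)) (lift-↑ʳ n ρ i))
           (trans (lookup-liftˢ-↑ʳ n s (ρ i))
           (trans (cong (wk n) (eq i)) (cong var (sym (lift-↑ʳ n ρ′ i))))))

  liftˢ-κ : ∀ n {s : Sub Σ θ₁ γ₃ γ′} {κ : Fin δ → Fin γ′} {κ′ : Fin δ′ → Fin γ₃} →
            (∀ i → Vec.lookup s (κ i) ≡ ren id id κ′ (Vec.lookup s₀ i)) →
            ∀ i → Vec.lookup (liftˢ n s) (n ↑ʳ κ i) ≡
                  ren id id ((n ↑ʳ_) ∘ κ′) (Vec.lookup s₀ i)
  liftˢ-κ n {s} {κ} {κ′} eq i = trans (lookup-liftˢ-↑ʳ n s (κ i))
    (trans (cong (wk n) (eq i)) (ren-ren (λ _ → refl) _))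

  -- The two hypotheses say that `s` merely renames the variables of the term and acts as `s₀` on
  -- those of `v`. This form is stable under binders, by `liftˢ-ρ` and `liftˢ-κ`.
  inst-[]  : ∀ {s : Sub Σ θ₁ γ₃ γ′} {ρ : Fin γ → Fin γ′} {ρ′ κ} {κ′ : Fin δ′ → Fin γ₃} →
             (∀ i → Vec.lookup s (ρ i) ≡ var (ρ′ i)) →
             (∀ i → Vec.lookup s (κ i) ≡ ren id id κ′ (Vec.lookup s₀ i)) →
             (t : Tm Σ θ₂ γ) → inst ρ κ v t [ s ] ≡ inst ρ′ κ′ (v [ s₀ ]ᴹ) t
  instˢ-[] : ∀ {s : Sub Σ θ₁ γ₃ γ′} {ρ : Fin γ → Fin γ′} {ρ′ κ} {κ′ : Fin δ′ → Fin γ₃} →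
             (∀ i → Vec.lookup s (ρ i) ≡ var (ρ′ i)) →
             (∀ i → Vec.lookup s (κ i) ≡ ren id id κ′ (Vec.lookup s₀ i)) →
             ∀ {n} (ts : Sub Σ θ₂ γ n) →
             instˢ ρ κ v ts [ s ]ˢ ≡ instˢ ρ′ κ′ (v [ s₀ ]ᴹ) ts
  instᴹ-[] : ∀ {s : Sub Σ θ₁ γ₃ γ′} {ρ : Fin γ → Fin γ′} {ρ′ κ} {κ′ : Fin δ′ → Fin γ₃} →
             (∀ i → Vec.lookup s (ρ i) ≡ var (ρ′ i)) →
             (∀ i → Vec.lookup s (κ i) ≡ ren id id κ′ (Vec.lookup s₀ i)) →
             (ts : MSub Σ θ₂ γ ξ) → instᴹ ρ κ v ts [ s ]ᴹ ≡ instᴹ ρ′ κ′ (v [ s₀ ]ᴹ) ts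
  inst-[] eρ eκ (var x) = eρ x
  inst-[] {s = s} {ρ} {ρ′} {κ} {κ′} eρ eκ (mvar x ts) = begin
    lookup v x [ A Vec.++ tabulate (var ∘ κ) ] [ s ]
      ≡⟨ []-[] _ s (lookup v x) ⟩
    lookup v x [ (A Vec.++ tabulate (var ∘ κ)) [ s ]ˢ ]
      ≡⟨ cong (lookup v x [_]) ([]ˢ-++ A _ s) ⟩
    lookup v x [ A [ s ]ˢ Vec.++ tabulate (var ∘ κ) [ s ]ˢ ]
      ≡⟨ cong (lookup v x [_]) (cong₂ Vec._++_ (instˢ-[] eρ eκ ts) κs) ⟩
    lookup v x [ A′ Vec.++ renˢ id id κ′ s₀ ]
      ≡⟨ cong (lookup v x [_]) (sym (liftˢ-++ A′)) ⟩
    lookup v x [ liftˢ _ s₀ [ A′ Vec.++ tabulate (var ∘ κ′) ]ˢ ]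
      ≡⟨ sym ([]-[] _ _ (lookup v x)) ⟩
    lookup v x [ liftˢ _ s₀ ] [ A′ Vec.++ tabulate (var ∘ κ′) ]
      ≡⟨ cong (_[ A′ Vec.++ tabulate (var ∘ κ′) ]) (sym (lookup-[]ᴹ v s₀ x)) ⟩
    lookup (v [ s₀ ]ᴹ) x [ A′ Vec.++ tabulate (var ∘ κ′) ] ∎
    where
    open ≡-Reasoning
    A = instˢ ρ κ v ts
    A′ = instˢ ρ′ κ′ (v [ s₀ ]ᴹ) ts
    κs : tabulate (var ∘ κ) [ s ]ˢ ≡ renˢ id id κ′ s₀
    κs = lookup-ext λ i → trans (lookup-[]ˢ (tabulate (var ∘ κ)) s i)
      (trans (cong (_[ s ]) (lookup∘tabulate (var ∘ κ) i))
      (trans (eκ i) (sym (lookup-renˢ κ′ s₀ i))))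
  inst-[] eρ eκ (op o ts) = cong (op o) (instᴹ-[] eρ eκ ts)
  instˢ-[] eρ eκ []       = refl
  instˢ-[] eρ eκ (t ∷ ts) = cong₂ _∷_ (inst-[] eρ eκ t) (instˢ-[] eρ eκ ts)
  instᴹ-[] eρ eκ [] = refl
  instᴹ-[] eρ eκ (_∷_ {x = n} t ts) =
    cong₂ _∷_ (inst-[] (liftˢ-ρ n eρ) (liftˢ-κ n eκ) t) (instᴹ-[] eρ eκ ts)

⟦⟧-[] : (t : Tm Σ θ₂ 0) (v : MSub Σ θ₁ γ θ₂) (s : Sub Σ θ₁ γ′ γ) →
        t ⟦ v ⟧ [ s ] ≡ t ⟦ v [ s ]ᴹ ⟧
-- `t` has no variables of its own, so the condition on `ρ` is vacuous; both `κ` and `κ′` are the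
-- identity.
⟦⟧-[] t v s = inst-[] (λ ()) (λ i → sym (ren-id (λ _ → refl) _)) t

⟦⟧ᴹ-[] : (ts : MSub Σ θ₂ 0 ξ) (v : MSub Σ θ₁ γ θ₂) (s : Sub Σ θ₁ γ′ γ) →
         ts ⟦ v ⟧ᴹ [ s ]ᴹ ≡ ts ⟦ v [ s ]ᴹ ⟧ᴹ
⟦⟧ᴹ-[] ts v s = instᴹ-[] (λ ()) (λ i → sym (ren-id (λ _ → refl) _)) ts

-- Cutting and gluing metavariable substitutions

++⁺-++⁻ : ∀ {A : Set} {P : A → Set} xs {ys} (ps : All P (xs ++ ys)) →
          ++⁺ (++⁻ˡ xs ps) (++⁻ʳ xs ps) ≡ ps
++⁺-++⁻ []       ps       = refl
++⁺-++⁻ (x ∷ xs) (p ∷ ps) = cong (p ∷_) (++⁺-++⁻ xs ps)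

lookup-++⁻ˡ : ∀ {A : Set} {P : A → Set} xs {ys} (ps : All P (xs ++ ys)) →
              ∀ {x} (i : x ∈ xs) → lookup ps (∈-++⁺ˡ i) ≡ lookup (++⁻ˡ xs ps) i
lookup-++⁻ˡ (x ∷ xs) (p ∷ ps) (here refl) = refl
lookup-++⁻ˡ (x ∷ xs) (p ∷ ps) (there i)   = lookup-++⁻ˡ xs ps i

lookup-++⁻ʳ : ∀ {A : Set} {P : A → Set} xs {ys} (ps : All P (xs ++ ys)) →
              ∀ {x} (i : x ∈ ys) → lookup ps (∈-++⁺ʳ xs i) ≡ lookup (++⁻ʳ xs ps) i
lookup-++⁻ʳ []       ps       i = refl
lookup-++⁻ʳ (x ∷ xs) (p ∷ ps) i = lookup-++⁻ʳ xs ps i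

++⁻ˡ-++⁺ : (v : MSub Σ θ γ θ₂) (w : MSub Σ θ γ θ₁) → ++⁻ˡ θ₂ (++⁺ v w) ≡ v
++⁻ˡ-++⁺ []      w = refl
++⁻ˡ-++⁺ (t ∷ v) w = cong (t ∷_) (++⁻ˡ-++⁺ v w)

++⁻ʳ-++⁺ : (v : MSub Σ θ γ θ₂) (w : MSub Σ θ γ θ₁) → ++⁻ʳ θ₂ (++⁺ v w) ≡ w
++⁻ʳ-++⁺ []      w = refl
++⁻ʳ-++⁺ (t ∷ v) w = ++⁻ʳ-++⁺ v w

lookup-++⁺ˡ : (v : MSub Σ θ γ θ₂) (w : MSub Σ θ γ θ₁) (x : δ ∈ θ₂) →
              lookup (++⁺ v w) (∈-++⁺ˡ x) ≡ lookup v x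
lookup-++⁺ˡ (t ∷ v) w (here refl) = refl
lookup-++⁺ˡ (t ∷ v) w (there x)   = lookup-++⁺ˡ v w x

-- Pattern instances

-- ⌊ p ⌋ ⟦ v ⟧ by recursion on p; the equation absorbs the reassociation
-- of scopes under binders.
fill  : γ + δ ≡ γ′ → TmP Σ θ γ → MSub Σ θ₁ δ θ → Tm Σ θ₁ γ′
fillᴹ : γ + δ ≡ γ′ → MSubP Σ θ γ ξ → MSub Σ θ₁ δ θ → MSub Σ θ₁ γ′ ξ
fill e meta (u ∷ [])  = subst (Tm _ _) e u
fill e (con c ps) v   = op c (fillᴹ e ps v)
fillᴹ e [] v = []
fillᴹ {γ = γ} {δ = δ} e (_∷_ {θ₂ = θ₂} {δ = n} p ps) v =
  fill (trans (+-assoc n γ δ) (cong (n +_) e)) p (++⁻ˡ θ₂ v) ∷ fillᴹ e ps (++⁻ʳ θ₂ v)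

toℕ-lift : ∀ n (ρ : Fin γ → Fin γ′) → (∀ i → toℕ (ρ i) ≡ toℕ i) →
           ∀ i → toℕ (lift n ρ i) ≡ toℕ i
toℕ-lift {γ} {γ′} n ρ eq = ↑-elim n _
  (λ i → trans (cong toℕ (lift-↑ˡ n ρ i)) (trans (toℕ-↑ˡ i γ′) (sym (toℕ-↑ˡ i γ))))
  (λ i → trans (cong toℕ (lift-↑ʳ n ρ i))
         (trans (toℕ-↑ʳ n (ρ i)) (trans (cong (n +_) (eq i)) (sym (toℕ-↑ʳ n i)))))

toℕ-↑ʳ-∘ : ∀ n (κ : Fin δ → Fin γ′) → (∀ j → toℕ (κ j) ≡ γ + toℕ j) →
           ∀ j → toℕ (n ↑ʳ κ j) ≡ n + γ + toℕ j
toℕ-↑ʳ-∘ {γ = γ} n κ eq j =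
  trans (toℕ-↑ʳ n (κ j)) (trans (cong (n +_) (eq j)) (sym (+-assoc n γ (toℕ j))))

-- Fixing the embeddings by their values under `toℕ` makes sense in any `γ′` equal to `γ + δ` and
-- survives binders without transports. At a metavariable they are then forced to be the two
-- injections, which together make up the identity substitution.
inst-⌊⌋  : (e : γ + δ ≡ γ′) {ρ : Fin γ → Fin γ′} {κ : Fin δ → Fin γ′} →
           (∀ i → toℕ (ρ i) ≡ toℕ i) → (∀ j → toℕ (κ j) ≡ γ + toℕ j) →
           (p : TmP Σ θ γ) (v : MSub Σ θ₁ δ θ) → inst ρ κ v ⌊ p ⌋ ≡ fill e p v
instᴹ-⌊⌋ : (e : γ + δ ≡ γ′) {ρ : Fin γ → Fin γ′} {κ : Fin δ → Fin γ′} →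
           (∀ i → toℕ (ρ i) ≡ toℕ i) → (∀ j → toℕ (κ j) ≡ γ + toℕ j) →
           (ps : MSubP Σ θ γ ξ) (v : MSub Σ θ₁ δ θ) → instᴹ ρ κ v ⌊ ps ⌋ᴹ ≡ fillᴹ e ps v
inst-⌊⌋ {γ = γ} {δ = δ} refl {ρ} {κ} eρ eκ meta (u ∷ []) = begin
  u [ instˢ ρ κ (u ∷ []) idˢ Vec.++ tabulate (var ∘ κ) ]
    ≡⟨ cong (λ s → u [ s Vec.++ tabulate (var ∘ κ) ])
         (trans (instˢ-map ρ κ _ idˢ) (sym (tabulate-∘ _ var))) ⟩
  u [ tabulate (var ∘ ρ) Vec.++ tabulate (var ∘ κ) ]
    ≡⟨ cong (u [_]) (cong₂ Vec._++_
         (tabulate-cong λ i → cong var (toℕ-injective (trans (eρ i) (sym (toℕ-↑ˡ i δ)))))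
         (tabulate-cong λ j → cong var (toℕ-injective (trans (eκ j) (sym (toℕ-↑ʳ γ j)))))) ⟩
  u [ tabulate (var ∘ (_↑ˡ δ)) Vec.++ tabulate (var ∘ (γ ↑ʳ_)) ]
    ≡⟨ cong (u [_]) (tabulate-++ γ var) ⟩
  u [ idˢ ]
    ≡⟨ []-idˢ u ⟩
  u ∎
  where open ≡-Reasoning
inst-⌊⌋ e eρ eκ (con c ps) v = cong (op c) (instᴹ-⌊⌋ e eρ eκ ps v)
instᴹ-⌊⌋ e eρ eκ [] v = refl
instᴹ-⌊⌋ {γ = γ} e {ρ} {κ} eρ eκ (_∷_ {θ₂ = θ₂} {δ = n} p ps) v = cong₂ _∷_
  (trans (inst-ren (lift n ρ) ((n ↑ʳ_) ∘ κ) ∈-++⁺ˡ (lookup-++⁻ˡ θ₂ v) (λ _ → refl) ⌊ p ⌋)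
         (inst-⌊⌋ _ (toℕ-lift n ρ eρ) (toℕ-↑ʳ-∘ {γ = γ} n κ eκ) p (++⁻ˡ θ₂ v)))
  (trans (instᴹ-ren ρ κ (∈-++⁺ʳ θ₂) (lookup-++⁻ʳ θ₂ v) (λ _ → refl) ⌊ ps ⌋ᴹ)
         (instᴹ-⌊⌋ e eρ eκ ps (++⁻ʳ θ₂ v)))

⌊⌋⟦⟧ : (p : TmP Σ θ γ) (v : MSub Σ θ₁ δ θ) → ⌊ p ⌋ ⟦ v ⟧ ≡ fill refl p v
⌊⌋⟦⟧ {γ = γ} {δ = δ} p v = inst-⌊⌋ refl (λ i → toℕ-↑ˡ i δ) (toℕ-↑ʳ γ) p v

⌊⌋⟦⟧ᴹ : (ps : MSubP Σ θ γ ξ) (v : MSub Σ θ₁ δ θ) → ⌊ ps ⌋ᴹ ⟦ v ⟧ᴹ ≡ fillᴹ refl ps v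
⌊⌋⟦⟧ᴹ {γ = γ} {δ = δ} ps v = instᴹ-⌊⌋ refl (λ i → toℕ-↑ˡ i δ) (toℕ-↑ʳ γ) ps v

-- Rewrite rules do not overlap

-- Replaces the newest symbol by a fresh metavariable: a common instance of
-- two patterns over the enlarged signature yields one over the old signature.
retract  : Tm (o ∷ Σ) θ γ → Tm Σ (0 ∷ θ) γ
retractˢ : Sub (o ∷ Σ) θ γ δ → Sub Σ (0 ∷ θ) γ δ
retractᴹ : MSub (o ∷ Σ) θ γ ξ → MSub Σ (0 ∷ θ) γ ξ
retract (var x)            = var x
retract (mvar x ts)        = mvar (there x) (retractˢ ts)
retract (op (here refl) _) = mvar (here refl) []
retract (op (there o) ts)  = op o (retractᴹ ts)
retractˢ []       = []
retractˢ (t ∷ ts) = retract t ∷ retractˢ ts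
retractᴹ []       = []
retractᴹ (t ∷ ts) = retract t ∷ retractᴹ ts

retractᴹ-++⁻ˡ : ∀ θ₂ {θ₁} (v : MSub (o ∷ Σ) θ γ (θ₂ ++ θ₁)) →
                retractᴹ (++⁻ˡ θ₂ v) ≡ ++⁻ˡ θ₂ (retractᴹ v)
retractᴹ-++⁻ˡ []       v       = refl
retractᴹ-++⁻ˡ (_ ∷ θ₂) (t ∷ v) = cong (retract t ∷_) (retractᴹ-++⁻ˡ θ₂ v)

retractᴹ-++⁻ʳ : ∀ θ₂ {θ₁} (v : MSub (o ∷ Σ) θ γ (θ₂ ++ θ₁)) →
                retractᴹ (++⁻ʳ θ₂ v) ≡ ++⁻ʳ θ₂ (retractᴹ v)
retractᴹ-++⁻ʳ []       v       = refl
retractᴹ-++⁻ʳ (_ ∷ θ₂) (t ∷ v) = retractᴹ-++⁻ʳ θ₂ v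

-- A pattern weakened from the old signature does not contain the newest symbol, so retraction
-- changes only what fills its metavariables.
retract-fill  : (e : γ + δ ≡ γ′) (p : TmP Σ θ γ) (v : MSub (o ∷ Σ) θ₁ δ θ) →
                retract (fill e (renP there p) v) ≡ fill e p (retractᴹ v)
retractᴹ-fill : (e : γ + δ ≡ γ′) (ps : MSubP Σ θ γ ξ) (v : MSub (o ∷ Σ) θ₁ δ θ) →
                retractᴹ (fillᴹ e (renPᴹ there ps) v) ≡ fillᴹ e ps (retractᴹ v)
retract-fill refl meta (u ∷ []) = refl
retract-fill e (con c ps) v     = cong (op c) (retractᴹ-fill e ps v)
retractᴹ-fill e [] v = refl
retractᴹ-fill e (_∷_ {θ₂ = θ₂} p ps) v = cong₂ _∷_
  (trans (retract-fill _ p (++⁻ˡ θ₂ v)) (cong (fill _ p) (retractᴹ-++⁻ˡ θ₂ v)))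
  (trans (retractᴹ-fill e ps (++⁻ʳ θ₂ v)) (cong (fillᴹ e ps) (retractᴹ-++⁻ʳ θ₂ v)))

-- Each rule was compared only with earlier ones, over the signature of its time, whereas instances
-- here may use symbols declared later. Induction on the theory retracts those symbols until the
-- later of the two rules is on top.
nonoverlap : (𝕋 : Theory Σ) {d : des ξ ∈ Σ}
             {ps₁ : MSubP Σ θ₁ 0 (arity (des ξ))} {ps₂ : MSubP Σ θ₂ 0 (arity (des ξ))} →
             ∀ {r₁ r₂} →
             (θ₁ ⊩ d ⦅ ps₁ ⦆↦ r₁) ∈ rewriteRules 𝕋 → (θ₂ ⊩ d ⦅ ps₂ ⦆↦ r₂) ∈ rewriteRules 𝕋 →
             (v₁ : MSub Σ θ γ θ₁) (v₂ : MSub Σ θ γ θ₂) → fillᴹ refl ps₁ v₁ ≡ fillᴹ refl ps₂ v₂ →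
             _≡_ {A = RewRule Σ} (θ₁ ⊩ d ⦅ ps₁ ⦆↦ r₁) (θ₂ ⊩ d ⦅ ps₂ ⦆↦ r₂)
nonoverlap (𝕋 ▹ R) m₁ m₂ v₁ v₂ eq
  -- A symbol declaration adds no rewrite rule, so both rules are weakened from `𝕋`, and their
  -- common head is an old symbol.
  with ∈-map⁻ (renRewRule there) m₁ | ∈-map⁻ (renRewRule there) m₂
... | (_ ⊩ d ⦅ ps₁ ⦆↦ r₁) , n₁ , refl | (_ ⊩ .d ⦅ ps₂ ⦆↦ r₂) , n₂ , refl
  = cong (renRewRule there) (nonoverlap 𝕋 n₁ n₂ (retractᴹ v₁) (retractᴹ v₂)
      (trans (sym (retractᴹ-fill refl ps₁ v₁))
             (trans (cong retractᴹ eq) (retractᴹ-fill refl ps₂ v₂))))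
nonoverlap (addRewrite 𝕋 θ d ts r ne) (here refl) (here refl) v₁ v₂ eq = refl
nonoverlap (addRewrite 𝕋 θ d ts r ne) {ps₂ = ps₂} (here refl) (there m₂) v₁ v₂ eq =
  ⊥-elim (ne m₂ v₁ v₂ (trans (⌊⌋⟦⟧ᴹ ts v₁) (trans eq (sym (⌊⌋⟦⟧ᴹ ps₂ v₂)))))
nonoverlap (addRewrite 𝕋 θ d ts r ne) {ps₁ = ps₁} (there m₁) (here refl) v₁ v₂ eq =
  ⊥-elim (ne m₁ v₂ v₁ (trans (⌊⌋⟦⟧ᴹ ts v₂) (trans (sym eq) (sym (⌊⌋⟦⟧ᴹ ps₁ v₁)))))
nonoverlap (addRewrite 𝕋 θ d ts r ne) (there m₁) (there m₂) v₁ v₂ eq =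
  nonoverlap 𝕋 m₁ m₂ v₁ v₂ eq

-- Every metavariable occurs in the pattern, applied to all variables of its scope, so each entry
-- can be read off from the instance.
fill-injective  : (e : γ + δ ≡ γ′) (p : TmP Σ θ γ) {v w : MSub Σ θ₁ δ θ} →
                  fill e p v ≡ fill e p w → v ≡ w
fillᴹ-injective : (e : γ + δ ≡ γ′) (ps : MSubP Σ θ γ ξ) {v w : MSub Σ θ₁ δ θ} →
                  fillᴹ e ps v ≡ fillᴹ e ps w → v ≡ w
fill-injective refl meta {u ∷ []} {w ∷ []} eq = cong (_∷ []) eq
fill-injective e (con c ps) eq = fillᴹ-injective e ps (op-inj eq)
  where
  op-inj : ∀ {o} {c : o ∈ Σ} {ts us : MSub Σ θ γ (arity o)} → op c ts ≡ op c us → ts ≡ us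
  op-inj refl = refl
fillᴹ-injective e [] {[]} {[]} eq = refl
fillᴹ-injective e (_∷_ {θ₂ = θ₂} p ps) {v} {w} eq =
  trans (sym (++⁺-++⁻ θ₂ v)) (trans (cong₂ ++⁺
    (fill-injective _ p (cong All.head eq))
    (fillᴹ-injective e ps (cong All.tail eq))) (++⁺-++⁻ θ₂ w))

-- Confluence

module Confluence {Σ : Sig} (𝕋 : Theory Σ) where
  open Judgments 𝕋

  -- Parallel reduction

  infix 4 _⇛_ _⇛ˢ_ _⇛ᴹ_

  -- In `root` it is the contents of the pattern that reduce in parallel with the contraction. The
  -- left-hand side enters through an equation, since a computed instance as index would obstruct
  -- case analysis.
  data _⇛_ {θ γ} : Tm Σ θ γ → Tm Σ θ γ → Set
  data _⇛ˢ_ {θ γ} : Sub Σ θ γ δ → Sub Σ θ γ δ → Set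
  data _⇛ᴹ_ {θ γ} : MSub Σ θ γ ξ → MSub Σ θ γ ξ → Set

  data _⇛_ {θ} {γ} where
    var  : ∀ {x} → var x ⇛ var x
    mvar : ∀ {x : δ ∈ θ} {ts us} → ts ⇛ˢ us → mvar x ts ⇛ mvar x us
    op   : ∀ {x : o ∈ Σ} {ts us} → ts ⇛ᴹ us → op x ts ⇛ op x us
    root : ∀ {d : des ξ ∈ Σ} {ps : MSubP Σ θ₁ 0 (arity (des ξ))} {r}
           {ts} {v w : MSub Σ θ γ θ₁} →
           (θ₁ ⊩ d ⦅ ps ⦆↦ r) ∈ rewriteRules 𝕋 → ts ≡ ⌊ ps ⌋ᴹ ⟦ v ⟧ᴹ → v ⇛ᴹ w →
           op d ts ⇛ r ⟦ w ⟧

  data _⇛ˢ_ {θ} {γ} where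
    []  : [] ⇛ˢ []
    _∷_ : ∀ {t u} {ts us : Sub Σ θ γ δ} → t ⇛ u → ts ⇛ˢ us → (t ∷ ts) ⇛ˢ (u ∷ us)

  data _⇛ᴹ_ {θ} {γ} where
    []  : [] ⇛ᴹ []
    _∷_ : ∀ {t u : Tm Σ θ (δ + γ)} {ts us : MSub Σ θ γ ξ} → t ⇛ u → ts ⇛ᴹ us →
          _⇛ᴹ_ {ξ = δ ∷ ξ} (t ∷ ts) (u ∷ us)

  ⇛-refl  : {t : Tm Σ θ γ} → t ⇛ t
  ⇛ˢ-refl : {ts : Sub Σ θ γ δ} → ts ⇛ˢ ts
  ⇛ᴹ-refl : {ts : MSub Σ θ γ ξ} → ts ⇛ᴹ ts
  ⇛-refl {t = var x}     = var
  ⇛-refl {t = mvar x ts} = mvar ⇛ˢ-refl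
  ⇛-refl {t = op o ts}   = op ⇛ᴹ-refl
  ⇛ˢ-refl {ts = []}     = []
  ⇛ˢ-refl {ts = t ∷ ts} = ⇛-refl ∷ ⇛ˢ-refl
  ⇛ᴹ-refl {ts = []}     = []
  ⇛ᴹ-refl {ts = t ∷ ts} = ⇛-refl ∷ ⇛ᴹ-refl

  -- Rewrite rules are closed, so renaming an instance of one renames only the metavariable
  -- substitution.
  ⇛-ren  : (ρ : Fin γ → Fin γ′) {t u : Tm Σ θ γ} → t ⇛ u → ren id id ρ t ⇛ ren id id ρ u
  ⇛ˢ-ren : (ρ : Fin γ → Fin γ′) {ts us : Sub Σ θ γ δ} → ts ⇛ˢ us →
           renˢ id id ρ ts ⇛ˢ renˢ id id ρ us
  ⇛ᴹ-ren : (ρ : Fin γ → Fin γ′) {ts us : MSub Σ θ γ ξ} → ts ⇛ᴹ us →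
           renᴹ id id ρ ts ⇛ᴹ renᴹ id id ρ us
  ⇛-ren ρ var = var
  ⇛-ren ρ (mvar r) = mvar (⇛ˢ-ren ρ r)
  ⇛-ren ρ (op r) = op (⇛ᴹ-ren ρ r)
  ⇛-ren ρ (root {ps = ps} {r} {v = v} {w} m refl vw) =
    subst (_ ⇛_) (sym (⟦⟧-ren r w)) (root m (⟦⟧ᴹ-ren ⌊ ps ⌋ᴹ v) (⇛ᴹ-ren ρ vw))
    where
    ⟦⟧-ren : (t : Tm Σ θ₂ 0) (v : MSub Σ _ _ θ₂) → ren id id ρ (t ⟦ v ⟧) ≡ t ⟦ renᴹ id id ρ v ⟧
    ⟦⟧-ren t v = trans (ren-as-[] ρ _)
      (trans (⟦⟧-[] t v _) (cong (t ⟦_⟧) (sym (renᴹ-as-[] ρ v))))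
    ⟦⟧ᴹ-ren : (ts : MSub Σ θ₂ 0 ξ) (v : MSub Σ _ _ θ₂) →
              renᴹ id id ρ (ts ⟦ v ⟧ᴹ) ≡ ts ⟦ renᴹ id id ρ v ⟧ᴹ
    ⟦⟧ᴹ-ren ts v = trans (renᴹ-as-[] ρ _)
      (trans (⟦⟧ᴹ-[] ts v _) (cong (ts ⟦_⟧ᴹ) (sym (renᴹ-as-[] ρ v))))
  ⇛ˢ-ren ρ []       = []
  ⇛ˢ-ren ρ (r ∷ rs) = ⇛-ren ρ r ∷ ⇛ˢ-ren ρ rs
  ⇛ᴹ-ren ρ [] = []
  ⇛ᴹ-ren ρ (_∷_ {δ = n} r rs) = ⇛-ren (lift n ρ) r ∷ ⇛ᴹ-ren ρ rs

  ⇛ˢ-++ : ∀ {m n} {ts us : Sub Σ θ γ m} {ts′ us′ : Sub Σ θ γ n} →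
          ts ⇛ˢ us → ts′ ⇛ˢ us′ → ts Vec.++ ts′ ⇛ˢ us Vec.++ us′
  ⇛ˢ-++ []       rs′ = rs′
  ⇛ˢ-++ (r ∷ rs) rs′ = r ∷ ⇛ˢ-++ rs rs′

  ⇛ˢ-lift : ∀ n {s s′ : Sub Σ θ γ′ γ} → s ⇛ˢ s′ → liftˢ n s ⇛ˢ liftˢ n s′
  ⇛ˢ-lift n {s} {s′} r = ⇛ˢ-++ ⇛ˢ-refl
    (subst₂ _⇛ˢ_ (renˢ-map _ s) (renˢ-map _ s′) (⇛ˢ-ren _ r))

  ⇛-lookupˢ : {s s′ : Sub Σ θ γ δ} → s ⇛ˢ s′ → ∀ i → Vec.lookup s i ⇛ Vec.lookup s′ i
  ⇛-lookupˢ (r ∷ rs) zero    = r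
  ⇛-lookupˢ (r ∷ rs) (suc i) = ⇛-lookupˢ rs i

  ⇛-lookupᴹ : {v w : MSub Σ θ γ ξ} → v ⇛ᴹ w → (x : δ ∈ ξ) → lookup v x ⇛ lookup w x
  ⇛-lookupᴹ (r ∷ rs) (here refl) = r
  ⇛-lookupᴹ (r ∷ rs) (there x)   = ⇛-lookupᴹ rs x

  ⇛-[]  : {t u : Tm Σ θ γ} {s s′ : Sub Σ θ γ′ γ} → t ⇛ u → s ⇛ˢ s′ → t [ s ] ⇛ u [ s′ ]
  ⇛ˢ-[] : {ts us : Sub Σ θ γ δ} {s s′ : Sub Σ θ γ′ γ} → ts ⇛ˢ us → s ⇛ˢ s′ →
          ts [ s ]ˢ ⇛ˢ us [ s′ ]ˢ
  ⇛ᴹ-[] : {ts us : MSub Σ θ γ ξ} {s s′ : Sub Σ θ γ′ γ} → ts ⇛ᴹ us → s ⇛ˢ s′ →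
          ts [ s ]ᴹ ⇛ᴹ us [ s′ ]ᴹ
  ⇛-[] (var {x}) ss = ⇛-lookupˢ ss x
  ⇛-[] (mvar r) ss  = mvar (⇛ˢ-[] r ss)
  ⇛-[] (op r) ss    = op (⇛ᴹ-[] r ss)
  ⇛-[] {s = s} {s′} (root {ps = ps} {r} {v = v} {w} m refl vw) ss =
    subst (_ ⇛_) (sym (⟦⟧-[] r w s′)) (root m (⟦⟧ᴹ-[] ⌊ ps ⌋ᴹ v s) (⇛ᴹ-[] vw ss))
  ⇛ˢ-[] []       ss = []
  ⇛ˢ-[] (r ∷ rs) ss = ⇛-[] r ss ∷ ⇛ˢ-[] rs ss
  ⇛ᴹ-[] [] ss = []
  ⇛ᴹ-[] (_∷_ {δ = n} r rs) ss = ⇛-[] r (⇛ˢ-lift n ss) ∷ ⇛ᴹ-[] rs ss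

  -- Used with `t` the right-hand side of a rule. At a metavariable the entry and its arguments
  -- reduce together, which is `⇛-[]`.
  ⇛-inst  : ∀ {ρ : Fin γ → Fin γ′} {κ : Fin δ → Fin γ′} {v w : MSub Σ θ₁ δ θ₂} →
            v ⇛ᴹ w → (t : Tm Σ θ₂ γ) → inst ρ κ v t ⇛ inst ρ κ w t
  ⇛ˢ-inst : ∀ {ρ : Fin γ → Fin γ′} {κ : Fin δ → Fin γ′} {v w : MSub Σ θ₁ δ θ₂} →
            v ⇛ᴹ w → ∀ {n} (ts : Sub Σ θ₂ γ n) → instˢ ρ κ v ts ⇛ˢ instˢ ρ κ w ts
  ⇛ᴹ-inst : ∀ {ρ : Fin γ → Fin γ′} {κ : Fin δ → Fin γ′} {v w : MSub Σ θ₁ δ θ₂} →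
            v ⇛ᴹ w → (ts : MSub Σ θ₂ γ ξ) → instᴹ ρ κ v ts ⇛ᴹ instᴹ ρ κ w ts
  ⇛-inst vw (var x)     = var
  ⇛-inst vw (mvar x ts) = ⇛-[] (⇛-lookupᴹ vw x) (⇛ˢ-++ (⇛ˢ-inst vw ts) ⇛ˢ-refl)
  ⇛-inst vw (op o ts)   = op (⇛ᴹ-inst vw ts)
  ⇛ˢ-inst vw []       = []
  ⇛ˢ-inst vw (t ∷ ts) = ⇛-inst vw t ∷ ⇛ˢ-inst vw ts
  ⇛ᴹ-inst vw []       = []
  ⇛ᴹ-inst vw (t ∷ ts) = ⇛-inst vw t ∷ ⇛ᴹ-inst vw ts

  ⇛ᴹ-++⁺ : {ts us : MSub Σ θ γ θ₂} {v w : MSub Σ θ γ θ₁} → ts ⇛ᴹ us → v ⇛ᴹ w →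
           ++⁺ ts v ⇛ᴹ ++⁺ us w
  ⇛ᴹ-++⁺ []       vw = vw
  ⇛ᴹ-++⁺ (r ∷ rs) vw = r ∷ ⇛ᴹ-++⁺ rs vw

  ⇛ᴹ-++⁻ˡ : ∀ θ₂ {v w : MSub Σ θ γ (θ₂ ++ θ₁)} → v ⇛ᴹ w → ++⁻ˡ θ₂ v ⇛ᴹ ++⁻ˡ θ₂ w
  ⇛ᴹ-++⁻ˡ []       vw       = []
  ⇛ᴹ-++⁻ˡ (_ ∷ θ₂) (r ∷ vw) = r ∷ ⇛ᴹ-++⁻ˡ θ₂ vw

  ⇛ᴹ-++⁻ʳ : ∀ θ₂ {v w : MSub Σ θ γ (θ₂ ++ θ₁)} → v ⇛ᴹ w → ++⁻ʳ θ₂ v ⇛ᴹ ++⁻ʳ θ₂ w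
  ⇛ᴹ-++⁻ʳ []       vw       = vw
  ⇛ᴹ-++⁻ʳ (_ ∷ θ₂) (r ∷ vw) = ⇛ᴹ-++⁻ʳ θ₂ vw

  -- Holds because patterns are linear and contain no destructor.
  fill-⇛⁻  : (e : γ + δ ≡ γ′) (p : TmP Σ θ γ) (v : MSub Σ θ₁ δ θ) {u : Tm Σ θ₁ γ′} →
             fill e p v ⇛ u → ∃[ w ] (u ≡ fill e p w × v ⇛ᴹ w)
  fillᴹ-⇛⁻ : (e : γ + δ ≡ γ′) (ps : MSubP Σ θ γ ξ) (v : MSub Σ θ₁ δ θ) {us : MSub Σ θ₁ γ′ ξ} →
             fillᴹ e ps v ⇛ᴹ us → ∃[ w ] (us ≡ fillᴹ e ps w × v ⇛ᴹ w)
  fill-⇛⁻ refl meta (t ∷ []) r = _ ∷ [] , refl , r ∷ []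
  fill-⇛⁻ e (con c ps) v (op rs) with fillᴹ-⇛⁻ e ps v rs
  ... | w , refl , vw = w , refl , vw
  fillᴹ-⇛⁻ e [] [] [] = [] , refl , []
  fillᴹ-⇛⁻ e (_∷_ {θ₂ = θ₂} p ps) v (r ∷ rs)
    with fill-⇛⁻ _ p (++⁻ˡ θ₂ v) r | fillᴹ-⇛⁻ e ps (++⁻ʳ θ₂ v) rs
  ... | w₂ , refl , vw₂ | w₁ , refl , vw₁ = ++⁺ w₂ w₁ ,
    cong₂ _∷_ (cong (fill _ p) (sym (++⁻ˡ-++⁺ w₂ w₁))) (cong (fillᴹ e ps) (sym (++⁻ʳ-++⁺ w₂ w₁))) ,
    subst (_⇛ᴹ _) (++⁺-++⁻ θ₂ v) (⇛ᴹ-++⁺ vw₂ vw₁)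

  -- The diamond property

  diamond  : (t : Tm Σ θ γ) → ∀ {a b} → t ⇛ a → t ⇛ b → ∃[ c ] (a ⇛ c × b ⇛ c)
  diamondˢ : (ts : Sub Σ θ γ δ) → ∀ {as bs} → ts ⇛ˢ as → ts ⇛ˢ bs → ∃[ cs ] (as ⇛ˢ cs × bs ⇛ˢ cs)
  diamondᴹ : (ts : MSub Σ θ γ ξ) → ∀ {as bs} → ts ⇛ᴹ as → ts ⇛ᴹ bs → ∃[ cs ] (as ⇛ᴹ cs × bs ⇛ᴹ cs)
  -- t and ts are separate arguments because the recursion runs on them.
  diamond-fill  : (t : Tm Σ θ₁ γ′) (e : γ + δ ≡ γ′) (p : TmP Σ θ γ) {v a b : MSub Σ θ₁ δ θ} →
                  t ≡ fill e p v → v ⇛ᴹ a → v ⇛ᴹ b → ∃[ c ] (a ⇛ᴹ c × b ⇛ᴹ c)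
  diamond-fillᴹ : (ts : MSub Σ θ₁ γ′ ξ) (e : γ + δ ≡ γ′) (ps : MSubP Σ θ γ ξ)
                  {v a b : MSub Σ θ₁ δ θ} →
                  ts ≡ fillᴹ e ps v → v ⇛ᴹ a → v ⇛ᴹ b → ∃[ c ] (a ⇛ᴹ c × b ⇛ᴹ c)
  -- A reduction of the arguments leaves the pattern intact, so `us` is again an instance, with
  -- reduced contents `v′`. After joining `w` and `v′`, the same rule contracts the new instance.
  diamond-root : ∀ {d : des ξ ∈ Σ} {ps : MSubP Σ θ₁ 0 (arity (des ξ))} {r}
                 (ts : MSub Σ θ γ (arity (des ξ))) {us} {v w : MSub Σ θ γ θ₁} → (θ₁ ⊩ d ⦅ ps ⦆↦ r) ∈ rewriteRules 𝕋 →
                 ts ≡ ⌊ ps ⌋ᴹ ⟦ v ⟧ᴹ → v ⇛ᴹ w → ts ⇛ᴹ us → ∃[ c ] (r ⟦ w ⟧ ⇛ c × op d us ⇛ c)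

  diamond (var x) var var = _ , var , var
  diamond (mvar x ts) (mvar r) (mvar r′) with diamondˢ ts r r′
  ... | _ , q , q′ = _ , mvar q , mvar q′
  diamond (op o ts) (op r) (op r′) with diamondᴹ ts r r′
  ... | _ , q , q′ = _ , op q , op q′
  diamond (op o ts) (root m eq vw) (op r′) = diamond-root ts m eq vw r′
  diamond (op o ts) (op r) (root m eq vw) with diamond-root ts m eq vw r
  ... | c , q , q′ = c , q′ , q
  diamond (op o ts) (root {ps = ps} {r} {v = v} m eq vw) (root {ps = ps′} {v = v′} m′ eq′ vw′)
    -- Two contractions of one redex use the same rule and, by injectivity, the same contents; only
    -- the reducts of the contents remain to be joined.
    with nonoverlap 𝕋 m m′ v v′
           (trans (sym (⌊⌋⟦⟧ᴹ ps v)) (trans (sym eq) (trans eq′ (⌊⌋⟦⟧ᴹ ps′ v′))))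
  ... | refl with fillᴹ-injective refl ps
           (trans (sym (⌊⌋⟦⟧ᴹ ps v)) (trans (sym eq) (trans eq′ (⌊⌋⟦⟧ᴹ ps v′))))
  ... | refl with diamond-fillᴹ ts refl ps (trans eq (⌊⌋⟦⟧ᴹ ps v)) vw vw′
  ... | _ , q , q′ = _ , ⇛-inst q r , ⇛-inst q′ r

  diamond-root {ps = ps} {r} ts {v = v} m eq vw rs
    with fillᴹ-⇛⁻ refl ps v (subst (_⇛ᴹ _) (trans eq (⌊⌋⟦⟧ᴹ ps v)) rs)
  ... | v′ , refl , vv′ with diamond-fillᴹ ts refl ps (trans eq (⌊⌋⟦⟧ᴹ ps v)) vw vv′
  ... | _ , q , q′ = _ , ⇛-inst q r , root m (sym (⌊⌋⟦⟧ᴹ ps v′)) q′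

  diamondˢ [] [] [] = [] , [] , []
  diamondˢ (t ∷ ts) (r ∷ rs) (r′ ∷ rs′) with diamond t r r′ | diamondˢ ts rs rs′
  ... | _ , q , q′ | _ , qs , qs′ = _ , q ∷ qs , q′ ∷ qs′
  diamondᴹ [] [] [] = [] , [] , []
  diamondᴹ (t ∷ ts) (r ∷ rs) (r′ ∷ rs′) with diamond t r r′ | diamondᴹ ts rs rs′
  ... | _ , q , q′ | _ , qs , qs′ = _ , q ∷ qs , q′ ∷ qs′

  diamond-fill t refl meta {u ∷ []} eq (r ∷ []) (r′ ∷ [])
    with diamond t (subst (_⇛ _) (sym eq) r) (subst (_⇛ _) (sym eq) r′)
  ... | _ , q , q′ = _ , q ∷ [] , q′ ∷ []
  diamond-fill (op _ ts) e (con c ps) refl r r′ = diamond-fillᴹ ts e ps refl r r′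
  diamond-fillᴹ [] e [] {[]} eq [] [] = [] , [] , []
  diamond-fillᴹ (t ∷ ts) e (_∷_ {θ₂ = θ₂} p ps) {v} {a} {b} eq r r′
    with diamond-fill t _ p (cong All.head eq) (⇛ᴹ-++⁻ˡ θ₂ r) (⇛ᴹ-++⁻ˡ θ₂ r′)
       | diamond-fillᴹ ts e ps (cong All.tail eq) (⇛ᴹ-++⁻ʳ θ₂ r) (⇛ᴹ-++⁻ʳ θ₂ r′)
  ... | _ , q₂ , q₂′ | _ , q₁ , q₁′ = _ ,
    subst (_⇛ᴹ _) (++⁺-++⁻ θ₂ a) (⇛ᴹ-++⁺ q₂ q₁) ,
    subst (_⇛ᴹ _) (++⁺-++⁻ θ₂ b) (⇛ᴹ-++⁺ q₂′ q₁′)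

  -- Comparison with one-step reduction

  ⟶⇒⇛  : {t u : Tm Σ θ γ} → t ⟶ u → t ⇛ u
  ⟶ˢ⇒⇛ : {t u : Sub Σ θ γ δ} → t ⟶ˢ u → t ⇛ˢ u
  ⟶ᴹ⇒⇛ : {t u : MSub Σ θ γ ξ} → t ⟶ᴹ u → t ⇛ᴹ u
  ⟶⇒⇛ (root m ts) = root m refl ⇛ᴹ-refl
  ⟶⇒⇛ (mvar r)    = mvar (⟶ˢ⇒⇛ r)
  ⟶⇒⇛ (op r)      = op (⟶ᴹ⇒⇛ r)
  ⟶ˢ⇒⇛ (here r)   = ⟶⇒⇛ r ∷ ⇛ˢ-refl
  ⟶ˢ⇒⇛ (there r)  = ⇛-refl ∷ ⟶ˢ⇒⇛ r
  ⟶ᴹ⇒⇛ (here r)   = ⟶⇒⇛ r ∷ ⇛ᴹ-refl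
  ⟶ᴹ⇒⇛ (there r)  = ⇛-refl ∷ ⟶ᴹ⇒⇛ r

  -- The step lies in one of the two halves; `Star` accounts for the other half, which does not
  -- move.
  ⟶ᴹ-++⁻ˡ : ∀ θ₂ {v w : MSub Σ θ γ (θ₂ ++ θ₁)} → v ⟶ᴹ w →
            Star _⟶ᴹ_ (++⁻ˡ θ₂ v) (++⁻ˡ θ₂ w)
  ⟶ᴹ-++⁻ˡ []       r         = ε
  ⟶ᴹ-++⁻ˡ (_ ∷ θ₂) (here r)  = here r ◅ ε
  ⟶ᴹ-++⁻ˡ (_ ∷ θ₂) {t ∷ _} (there r) = Star.gmap (t ∷_) there (⟶ᴹ-++⁻ˡ θ₂ r)

  ⟶ᴹ-++⁻ʳ : ∀ θ₂ {v w : MSub Σ θ γ (θ₂ ++ θ₁)} → v ⟶ᴹ w →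
            Star _⟶ᴹ_ (++⁻ʳ θ₂ v) (++⁻ʳ θ₂ w)
  ⟶ᴹ-++⁻ʳ []       r         = r ◅ ε
  ⟶ᴹ-++⁻ʳ (_ ∷ θ₂) (here r)  = ε
  ⟶ᴹ-++⁻ʳ (_ ∷ θ₂) (there r) = ⟶ᴹ-++⁻ʳ θ₂ r

  ∷-⟶* : {t u : Tm Σ θ (δ + γ)} {ts us : MSub Σ θ γ ξ} → t ⟶* u → Star _⟶ᴹ_ ts us →
         Star (_⟶ᴹ_ {ξ = δ ∷ ξ}) (t ∷ ts) (u ∷ us)
  ∷-⟶* {u = u} {ts = ts} r rs = Star.gmap (_∷ ts) here r ◅◅ Star.gmap (u ∷_) there rs

  fill-⟶  : (e : γ + δ ≡ γ′) (p : TmP Σ θ γ) {v w : MSub Σ θ₁ δ θ} → v ⟶ᴹ w →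
            fill e p v ⟶* fill e p w
  fillᴹ-⟶ : (e : γ + δ ≡ γ′) (ps : MSubP Σ θ γ ξ) {v w : MSub Σ θ₁ δ θ} → v ⟶ᴹ w →
            Star _⟶ᴹ_ (fillᴹ e ps v) (fillᴹ e ps w)
  fill-⟶ refl meta {_ ∷ []} (here r) = r ◅ ε
  fill-⟶ e (con c ps) r = Star.gmap (op c) op (fillᴹ-⟶ e ps r)
  fillᴹ-⟶ e [] r = ε
  fillᴹ-⟶ e (_∷_ {θ₂ = θ₂} p ps) r = ∷-⟶*
    (Star.kleisliStar (fill _ p) (fill-⟶ _ p) (⟶ᴹ-++⁻ˡ θ₂ r))
    (Star.kleisliStar (fillᴹ e ps) (fillᴹ-⟶ e ps) (⟶ᴹ-++⁻ʳ θ₂ r))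

  ⇛⇒⟶*  : {t u : Tm Σ θ γ} → t ⇛ u → t ⟶* u
  ⇛ˢ⇒⟶* : {t u : Sub Σ θ γ δ} → t ⇛ˢ u → Star _⟶ˢ_ t u
  ⇛ᴹ⇒⟶* : {t u : MSub Σ θ γ ξ} → t ⇛ᴹ u → Star _⟶ᴹ_ t u
  ⇛⇒⟶* var      = ε
  ⇛⇒⟶* (mvar r) = Star.gmap (mvar _) mvar (⇛ˢ⇒⟶* r)
  ⇛⇒⟶* (op {x = x} r) = Star.gmap (op x) op (⇛ᴹ⇒⟶* r)
  -- The contents are reduced first, inside the left-hand side, and the redex is contracted last.
  ⇛⇒⟶* (root {d = d} {ps} {v = v} {w} m refl vw) =
    Star.gmap (op d) op (subst₂ (Star _⟶ᴹ_) (sym (⌊⌋⟦⟧ᴹ ps v)) (sym (⌊⌋⟦⟧ᴹ ps w))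
      (Star.kleisliStar (fillᴹ refl ps) (fillᴹ-⟶ refl ps) (⇛ᴹ⇒⟶* vw)))
    ◅◅ root m w ◅ ε
  ⇛ˢ⇒⟶* [] = ε
  ⇛ˢ⇒⟶* (_∷_ {u = u} {ts} r rs) =
    Star.gmap (_∷ ts) here (⇛⇒⟶* r) ◅◅ Star.gmap (u ∷_) there (⇛ˢ⇒⟶* rs)
  ⇛ᴹ⇒⟶* []       = ε
  ⇛ᴹ⇒⟶* (r ∷ rs) = ∷-⟶* (⇛⇒⟶* r) (⇛ᴹ⇒⟶* rs)

  -- Convertibility to a constructor

  strip : {t a b : Tm Σ θ γ} → Star _⇛_ t a → t ⇛ b → ∃[ c ] (a ⇛ c × Star _⇛_ b c)
  strip ε q = _ , q , ε
  strip (r ◅ rs) q with diamond _ r q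
  ... | _ , q′ , r′ with strip rs q′
  ... | _ , q″ , rs′ = _ , q″ , r′ ◅ rs′

  -- Induction along the conversion, carrying a reduction to the head `c` from `u` back to `t`.
  -- Forward steps are prepended; backward steps need `strip`.
  ≈-con : ∀ {c : con ξ ∈ Σ} {ts : MSub Σ θ γ ξ} {t u} → u ⟶* op c ts → t ≈ u →
          ∃[ us ] (t ⟶* op c us × ts ≈ᴹ us)
  ≈-con u⟶ ε = _ , u⟶ , ε
  ≈-con u⟶ (fwd r ◅ rs) with ≈-con u⟶ rs
  ... | us , t⟶ , eq = us , r ◅ t⟶ , eq
  ≈-con u⟶ (bwd r ◅ rs) with ≈-con u⟶ rs
  -- Only destructors head a redex, so what `op c us` reduces to still has head `c`.
  ... | us , t⟶ , eq with strip (Star.map ⟶⇒⇛ t⟶) (⟶⇒⇛ r)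
  ... | _ , op q , t′⇛ = _ , Star.concat (Star.map ⇛⇒⟶* t′⇛) , eq ◅◅ Star.map fwd (⇛ᴹ⇒⟶* q)

module Completeness {Σ : Sig} (𝕋 : Theory Σ) where
  open Judgments 𝕋
  open Confluence 𝕋

  -- Congruence properties of convertibility

  ≈-sym : {t u : Tm Σ θ γ} → t ≈ u → u ≈ t
  ≈-sym = Eq.symmetric _⟶_

  ≈ᴹ-sym : {ts us : MSub Σ θ γ ξ} → ts ≈ᴹ us → us ≈ᴹ ts
  ≈ᴹ-sym = Eq.symmetric _⟶ᴹ_

  -- Here and for instances, a step is read as a parallel one, transported by the stability of
  -- `_⇛_`, and unfolded into steps again.
  wk-≈ : ∀ n {t u : Tm Σ θ γ} → t ≈ u → wk n t ≈ wk n u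
  wk-≈ n = Eq.gfold (Eq.isEquivalence _⟶_) (wk n)
    (Star.map fwd ∘ ⇛⇒⟶* ∘ ⇛-ren _ ∘ ⟶⇒⇛)

  ⟦⟧-≈ : (t : Tm Σ θ₂ γ) {v w : MSub Σ θ₁ δ θ₂} → v ≈ᴹ w → t ⟦ v ⟧ ≈ t ⟦ w ⟧
  ⟦⟧-≈ t = Eq.gfold (Eq.isEquivalence _⟶_) (t ⟦_⟧)
    λ r → Star.map fwd (⇛⇒⟶* (⇛-inst (⟶ᴹ⇒⇛ r) t))

  ⟦⟧ᴹ-≈ : (ts : MSub Σ θ₂ γ ξ) {v w : MSub Σ θ₁ δ θ₂} → v ≈ᴹ w → ts ⟦ v ⟧ᴹ ≈ᴹ ts ⟦ w ⟧ᴹ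
  ⟦⟧ᴹ-≈ ts = Eq.gfold (Eq.isEquivalence _⟶ᴹ_) (ts ⟦_⟧ᴹ)
    λ r → Star.map fwd (⇛ᴹ⇒⟶* (⇛ᴹ-inst (⟶ᴹ⇒⇛ r) ts))

  subst-≈ : (e : γ ≡ γ′) {t u : Tm Σ θ γ} → t ≈ u → subst (Tm Σ θ) e t ≈ subst (Tm Σ θ) e u
  subst-≈ refl eq = eq

  ≈ᴹ-head : {t u : Tm Σ θ (δ + γ)} {ts us : MSub Σ θ γ ξ} →
            _≈ᴹ_ {ξ = δ ∷ ξ} (t ∷ ts) (u ∷ us) → t ≈ u
  ≈ᴹ-head = Eq.gfold (Eq.isEquivalence _⟶_) All.head λ { (here r) → Eq.return r ; (there _) → ε }

  ≈ᴹ-tail : {t u : Tm Σ θ (δ + γ)} {ts us : MSub Σ θ γ ξ} →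
            _≈ᴹ_ {ξ = δ ∷ ξ} (t ∷ ts) (u ∷ us) → ts ≈ᴹ us
  ≈ᴹ-tail = Eq.gfold (Eq.isEquivalence _⟶ᴹ_) All.tail λ { (here _) → ε ; (there r) → Eq.return r }

  ∷-≈ᴹ : {t u : Tm Σ θ (δ + γ)} {ts us : MSub Σ θ γ ξ} → t ≈ u → ts ≈ᴹ us →
         _≈ᴹ_ {ξ = δ ∷ ξ} (t ∷ ts) (u ∷ us)
  ∷-≈ᴹ {u = u} {ts} eq eqs = Eq.gmap (_∷ ts) here eq ◅◅ Eq.gmap (u ∷_) there eqs

  ++⁺-≈ᴹ : {ts us : MSub Σ θ γ θ₂} {v w : MSub Σ θ γ θ₁} → ts ≈ᴹ us → v ≈ᴹ w →
           ++⁺ ts v ≈ᴹ ++⁺ us w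
  ++⁺-≈ᴹ {ts = []}     {[]}     _   eq = eq
  ++⁺-≈ᴹ {ts = _ ∷ _} {_ ∷ _} eqs eq = ∷-≈ᴹ (≈ᴹ-head eqs) (++⁺-≈ᴹ (≈ᴹ-tail eqs) eq)

  ++⁺-≈ᴹ⁻ : {ts us : MSub Σ θ γ θ₂} {v w : MSub Σ θ γ θ₁} →
            ++⁺ ts v ≈ᴹ ++⁺ us w → ts ≈ᴹ us × v ≈ᴹ w
  ++⁺-≈ᴹ⁻ {ts = []}     {[]}     eq = ε , eq
  ++⁺-≈ᴹ⁻ {ts = _ ∷ _} {_ ∷ _} eq with ++⁺-≈ᴹ⁻ (≈ᴹ-tail eq)
  ... | eqs , eq′ = ∷-≈ᴹ (≈ᴹ-head eq) eqs , eq′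

  -- Matching

  -- By `≈-con`, each constructor demanded by the pattern is also reached from `u`, with convertible
  -- arguments; at a metavariable the conversion itself relates the entries.
  ≺-resp-≈  : {p : TmP Σ θ γ} {t u : Tm Σ [] (γ + δ)} {v : MSub Σ [] δ θ} →
              p ≺ t ↝ v → t ≈ u → ∃[ w ] (p ≺ u ↝ w × v ≈ᴹ w)
  ≺ᴹ-resp-≈ : {ps : MSubP Σ θ γ ξ} {ts us : MSub Σ [] (γ + δ) ξ} {v : MSub Σ [] δ θ} →
              ps ≺ᴹ ts ↝ v → ts ≈ᴹ us → ∃[ w ] (ps ≺ᴹ us ↝ w × v ≈ᴹ w)
  ≺-resp-≈ meta eq = _ , meta , ∷-≈ᴹ eq ε
  ≺-resp-≈ (con t⟶ ms) eq with ≈-con t⟶ (≈-sym eq)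
  ... | _ , u⟶ , eqs with ≺ᴹ-resp-≈ ms eqs
  ... | w , ms′ , vw = w , con u⟶ ms′ , vw
  ≺ᴹ-resp-≈ {us = []} [] eq = [] , [] , ε
  ≺ᴹ-resp-≈ {γ = γ} {δ = δ} {us = _ ∷ _} (_∷_ {δ′ = n} m ms) eq
    with ≺-resp-≈ m (subst-≈ (sym (+-assoc n γ δ)) (≈ᴹ-head eq)) | ≺ᴹ-resp-≈ ms (≈ᴹ-tail eq)
  ... | _ , m′ , vw₂ | _ , ms′ , vw₁ = _ , m′ ∷ ms′ , ++⁺-≈ᴹ vw₂ vw₁

  -- The transport built into matching under binders cancels the equation that `fill` accumulates
  -- there.
  fill-subst : (e₁ : γ + δ ≡ γ′) (e₂ : γ + δ ≡ γ′) (p : TmP Σ θ γ) (v : MSub Σ θ₁ δ θ) →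
               subst (Tm Σ θ₁) (sym e₁) (fill e₂ p v) ≡ fill refl p v
  fill-subst refl refl p v = refl

  fill-≺  : (p : TmP Σ θ γ) (v : MSub Σ [] δ θ) → p ≺ fill refl p v ↝ v
  fillᴹ-≺ : (ps : MSubP Σ θ γ ξ) (v : MSub Σ [] δ θ) → ps ≺ᴹ fillᴹ refl ps v ↝ v
  fill-≺ meta (u ∷ []) = meta
  fill-≺ (con c ps) v  = con ε (fillᴹ-≺ ps v)
  fillᴹ-≺ [] [] = []
  fillᴹ-≺ {γ = γ} {δ = δ} (_∷_ {θ₂ = θ₂} {δ = n} p ps) v = 
    subst (p ∷ ps ≺ᴹ fillᴹ refl (p ∷ ps) v ↝_) (++⁺-++⁻ θ₂ v)
    (subst (p ≺_↝ _) (sym (fill-subst (+-assoc n γ δ) (trans (+-assoc n γ δ) refl) p _))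
      (fill-≺ p (++⁻ˡ θ₂ v))
     ∷ fillᴹ-≺ ps (++⁻ʳ θ₂ v))

  ≺-instance : (p : TmP Σ θ γ) (v : MSub Σ [] δ θ) → p ≺ ⌊ p ⌋ ⟦ v ⟧ ↝ v
  ≺-instance p v = subst (p ≺_↝ v) (sym (⌊⌋⟦⟧ p v)) (fill-≺ p v)

  -- Conversion of bidirectional judgments

  infix 4 _≈ᶜ_

  -- Contexts vary because `ExtMSub` extends them by types instantiated with the recovered
  -- parameters, which are known only up to conversion.
  data _≈ᶜ_ {θ} : Ctx Σ θ γ → Ctx Σ θ γ → Set where
    []  : [] ≈ᶜ []
    _▹_ : {Γ Γ′ : Ctx Σ θ γ} {T T′ : Tm Σ θ γ} → Γ ≈ᶜ Γ′ → T ≈ T′ → Γ ▹ T ≈ᶜ Γ′ ▹ T′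

  ≈ᶜ-refl : {Γ : Ctx Σ θ γ} → Γ ≈ᶜ Γ
  ≈ᶜ-refl {Γ = []}    = []
  ≈ᶜ-refl {Γ = Γ ▹ T} = ≈ᶜ-refl ▹ ε

  ≈ᶜ-▸ : {Γ Γ′ : Ctx Σ θ₁ γ} (Δ : Ctx Σ θ₂ δ) {v w : MSub Σ θ₁ γ θ₂} → Γ ≈ᶜ Γ′ → v ≈ᴹ w →
         Γ ▸ Δ ⟪ v ⟫ ≈ᶜ Γ′ ▸ Δ ⟪ w ⟫
  ≈ᶜ-▸ []      ΓΓ′ vw = ΓΓ′
  ≈ᶜ-▸ (Δ ▹ T) ΓΓ′ vw = ≈ᶜ-▸ Δ ΓΓ′ vw ▹ ⟦⟧-≈ T vw

  ctxLookup-≈ : {Γ Γ′ : Ctx Σ θ γ} → Γ ≈ᶜ Γ′ → ∀ x → ctxLookup Γ x ≈ ctxLookup Γ′ x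
  ctxLookup-≈ (_   ▹ eq) zero    = wk-≈ 1 eq
  ctxLookup-≈ (ΓΓ′ ▹ _)  (suc x) = wk-≈ 1 (ctxLookup-≈ ΓΓ′ x)

  private variable
    Γ Γ′ : Ctx Σ [] γ

  -- The bidirectional expression stays fixed, so its erasure does too; only the matched parameters,
  -- the context and the inferred types move, each within its convertibility class.
  conv⇐sort : Γ ≈ᶜ Γ′ → ∀ {T} → Γ ⊢ T ⇐sort → Γ′ ⊢ T ⇐sort
  conv⇐     : Γ ≈ᶜ Γ′ → ∀ {t T T′} → T ≈ T′ → Γ ⊢ t ⇐ T → Γ′ ⊢ t ⇐ T′
  conv⇒     : Γ ≈ᶜ Γ′ → ∀ {t T} → Γ ⊢ t ⇒ T → ∃[ T′ ] (T ≈ T′ × (Γ′ ⊢ t ⇒ T′))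
  convᴹ     : Γ ≈ᶜ Γ′ → ∀ {v w} {Θ : MCtx Σ θ} {Ξ : MTel Σ θ ξ} {ts} → v ≈ᴹ w →
              Γ ∣ v ∶ Θ ⊢ ts ⇐ Ξ → Γ′ ∣ w ∶ Θ ⊢ ts ⇐ Ξ
  conv⇐sort ΓΓ′ (Sort eq ts) = Sort eq (convᴹ ΓΓ′ ε ts)
  conv⇐ ΓΓ′ TT′ (Cons {ξp = ξp} {ξi = ξi} {vi = vi} eq m us tieq) with ≺-resp-≈ m TT′
  -- The new match is cut into indices and parameters, the form that `Cons` requires.
  ... | w , m′ , vw with ++⁻ˡ ξi w | ++⁻ʳ ξi w | ++⁺-++⁻ ξi w
  ... | ti′ | _ | refl with ++⁺-≈ᴹ⁻ {us = ti′} vw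
  ... | titi′ , tptp′ = Cons eq m′ (convᴹ ΓΓ′ tptp′ us)
    -- New indices, old indices, their value at the old parameters, their value at the new ones.
    (≈ᴹ-sym titi′ ◅◅ tieq ◅◅ ⟦⟧ᴹ-≈ vi (++⁺-≈ᴹ ε tptp′))
  conv⇐ ΓΓ′ TT′ (Switch t eq) with conv⇒ ΓΓ′ t
  ... | _ , TT″ , t′ = Switch t′ (≈-sym TT″ ◅◅ eq ◅◅ TT′)
  conv⇒ ΓΓ′ (Var x) = _ , ctxLookup-≈ ΓΓ′ x , Var x
  conv⇒ ΓΓ′ (Annot T t) = _ , ε , Annot (conv⇐sort ΓΓ′ T) (conv⇐ ΓΓ′ ε t)
  conv⇒ ΓΓ′ (Dest {U = U} eq t m us) with conv⇒ ΓΓ′ t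
  ... | _ , TT′ , t′ with ≺-resp-≈ m TT′
  ... | w , m′ , vw = _ , ⟦⟧-≈ U (++⁺-≈ᴹ ε (∷-≈ᴹ ε vw)) , Dest eq t′ m′ (convᴹ ΓΓ′ (∷-≈ᴹ ε vw) us)
  convᴹ ΓΓ′ vw EmptyMSub = EmptyMSub
  convᴹ ΓΓ′ vw (ExtMSub {Δ = Δ} {T = T} ts t) =
    ExtMSub (convᴹ ΓΓ′ vw ts) (conv⇐ (≈ᶜ-▸ Δ ΓΓ′ vw′) (⟦⟧-≈ T vw′) t)
    where vw′ = ++⁺-≈ᴹ ε vw

  -- Annotation

  -- Used at empty `w`: the arguments of a sort are typed declaratively against `Ξ` but checked
  -- against `weaken Ξ`.
  weaken-⟦⟧ : (t : Tm Σ θ₂ γ) (v : MSub Σ [] δ θ₂) (w : MSub Σ [] δ θ₁) →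
              ren id ∈-++⁺ˡ id t ⟦ ++⁺ v w ⟧ ≡ t ⟦ v ⟧
  weaken-⟦⟧ t v w = inst-ren _ _ ∈-++⁺ˡ (lookup-++⁺ˡ v w) (λ _ → refl) t

  weaken-▸ : (Γ : Ctx Σ [] γ) (Δ : Ctx Σ θ₂ δ) (v : MSub Σ [] γ θ₂) (w : MSub Σ [] γ θ₁) →
             Γ ▸ renCtx id ∈-++⁺ˡ Δ ⟪ ++⁺ v w ⟫ ≡ Γ ▸ Δ ⟪ v ⟫
  weaken-▸ Γ []      v w = refl
  weaken-▸ Γ (Δ ▹ T) v w = cong₂ _▹_ (weaken-▸ Γ Δ v w) (weaken-⟦⟧ T v w)

  annotate⇐     : ∀ {t T} → [] ⨾ Γ ⊢ t ∶ T →
                  ∃[ t′ ] (MinimalC t′ × ⌜ t′ ⌝ᶜ ≡ t × (Γ ⊢ t′ ⇐ T))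
  annotate⇒     : ∀ {t T} → [] ⨾ Γ ⊢ t ∶ T →
                  ∃[ T′ ] ∃[ t′ ] (T′ ≈ T × MinimalI t′ × ⌜ t′ ⌝ⁱ ≡ t × (Γ ⊢ t′ ⇒ T′))
  annotate⇐sort : ∀ {T} → [] ⨾ Γ ⊢ T sort →
                  ∃[ T′ ] (MinimalC T′ × ⌜ T′ ⌝ᶜ ≡ T × (Γ ⊢ T′ ⇐sort))
  -- Recursion on `Ξ` and `ts` makes both concatenations compute, so that the derivation can be
  -- peeled entry by entry.
  annotateᴹ     : ∀ {Γ : Ctx Σ [] γ} {Θ : MCtx Σ θ} (Ξ : MTel Σ θ ξ) {v} (ts : MSub Σ [] γ ξ) →
                  [] ⨾ Γ ⊢ᴹ ++⁺ ts v ∶ (Θ ⧺ Ξ) →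
                  ∃[ ts′ ] (MinimalM ts′ × ⌜ ts′ ⌝ᴹ ≡ ts × (Γ ∣ v ∶ Θ ⊢ ts′ ⇐ Ξ))
  annotate-weaken : ∀ {Γ : Ctx Σ [] γ} {Ξ : MCtx Σ ξ} {ts : MSub Σ [] γ ξ} → [] ⨾ Γ ⊢ᴹ ts ∶ Ξ →
                    ∃[ ts′ ] (MinimalM ts′ × ⌜ ts′ ⌝ᴹ ≡ ts × (Γ ∣ [] ∶ [] ⊢ ts′ ⇐ weaken Ξ))
  -- The typing of the principal argument sits below the entries `ts`; it is dug out and annotated
  -- in inferring mode, as `Dest` demands.
  annotate-principal : ∀ {Γ : Ctx Σ [] γ} {Θ : MCtx Σ θ} {T} (Ξ : MTel Σ (0 ∷ θ) ξ)
                       {t v} (ts : MSub Σ [] γ ξ) →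
                       [] ⨾ Γ ⊢ᴹ ++⁺ ts (t ∷ v) ∶ ((Θ ▹ [] ∶ T) ⧺ Ξ) →
                       ∃[ T′ ] ∃[ t′ ] (T′ ≈ T ⟦ v ⟧ × MinimalI t′ × ⌜ t′ ⌝ⁱ ≡ t × (Γ ⊢ t′ ⇒ T′))
  annotate-cons : ∀ {Γ : Ctx Σ [] γ} {c : con ξc ∈ Σ} {Ξp : MCtx Σ ξp} {Ξc}
                  {Ξi : MTel Σ ξp ξi} {vi T} {tp : MSub Σ [] γ ξp} {ts : MSub Σ [] γ ξc} →
                  rule 𝕋 c ≡ cons Ξp Ξc Ξi vi T → [] ⨾ Γ ⊢ᴹ ++⁺ ts tp ∶ (Ξp ⧺ Ξc) →
                  ∃[ us ] (MinimalM us × ⌜ us ⌝ᴹ ≡ ts ×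
                    (Γ ⊢ con c us ⇐ ⌊ T ⌋ ⟦ ++⁺ (vi ⟦ ++⁺ ts tp ⟧ᴹ) tp ⟧))
  annotate-dest : ∀ {Γ : Ctx Σ [] γ} {d : des ξd ∈ Σ} {Ξpi : MCtx Σ ξp} {T Ξd U}
                  {tpi : MSub Σ [] γ ξp} {t : Tm Σ [] γ} {ts : MSub Σ [] γ ξd} →
                  rule 𝕋 d ≡ dest Ξpi T Ξd U →
                  [] ⨾ Γ ⊢ᴹ ++⁺ ts (t ∷ tpi) ∶ ((Ξpi ▹ [] ∶ ⌊ T ⌋) ⧺ Ξd) →
                  ∃[ U′ ] ∃[ t′ ] ∃[ us ] (U′ ≈ U ⟦ ++⁺ ts (t ∷ tpi) ⟧ ×
                    MinimalI (des d t′ us) × ⌜ des d t′ us ⌝ⁱ ≡ op d (++⁺ ts (t ∷ [])) ×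
                    (Γ ⊢ des d t′ us ⇒ U′))

  annotate⇐ (Var x _)    = underline (var x) , underline (λ _ _ ()) var , refl , Switch (Var x) ε
  annotate⇐ (MVar () _)
  annotate⇐ (Cons {c = c} {tp = tp} {ts} eq D _) with annotate-cons {tp = tp} {ts} eq D
  ... | us , min , refl , c⇐ = con c us , con min , refl , c⇐
  annotate⇐ (Dest {d = d} {tpi = tpi} {t} {ts} eq D) with annotate-dest {tpi = tpi} {t} {ts} eq D
  ... | _ , t′ , us , U≈ , min , er , d⇒ =
    underline (des d t′ us) , underline (λ _ _ ()) min , er , Switch d⇒ U≈
  annotate⇐ (Conv D T≈U _) with annotate⇐ D
  ... | t′ , min , er , t⇐ = t′ , min , er , conv⇐ ≈ᶜ-refl T≈U t⇐

  annotate⇒ (Var x _)    = _ , var x , ε , var , refl , Var x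
  annotate⇒ (MVar () _)
  annotate⇒ (Cons {c = c} {tp = tp} {ts} eq D S)
    with annotate-cons {tp = tp} {ts} eq D | annotate⇐sort S
  ... | us , min , refl , c⇐ | T′ , minT , er , T⇐ =
    -- The ascribed `T′` is the annotation of the sort premise `S`. The ascription is minimal
    -- because its subject is a constructor, not an underlined term.
    _ , con c us ⦂ T′ , ≡⇒≈ er , asc (λ _ ()) (con min) minT , refl ,
    Annot T⇐ (subst (_ ⊢ con c us ⇐_) (sym er) c⇐)
    where
    ≡⇒≈ : {t u : Tm Σ [] γ} → t ≡ u → t ≈ u
    ≡⇒≈ refl = ε
  annotate⇒ (Dest {d = d} {tpi = tpi} {t} {ts} eq D) with annotate-dest {tpi = tpi} {t} {ts} eq D
  ... | U′ , t′ , us , U≈ , min , er , d⇒ = U′ , des d t′ us , U≈ , min , er , d⇒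
  annotate⇒ (Conv D T≈U _) with annotate⇒ D
  ... | T′ , t′ , T′≈ , min , er , t⇒ = T′ , t′ , T′≈ ◅◅ T≈U , min , er , t⇒

  annotate⇐sort (Sort {c = c} eq D) with annotate-weaken D
  ... | ts′ , min , refl , ts⇐ = con c ts′ , con min , refl , Sort eq ts⇐

  annotateᴹ [] [] D = [] , [] , refl , EmptyMSub
  annotateᴹ (Ξ ▹ Δ ∶ T) (t ∷ ts) (ext D Dt) with annotateᴹ Ξ ts D | annotate⇐ Dt
  ... | ts′ , mins , refl , ts⇐ | t′ , min , refl , t⇐ =
    t′ ∷ ts′ , min ∷ mins , refl , ExtMSub ts⇐ t⇐

  annotate-weaken ([] _) = [] , [] , refl , EmptyMSub
  annotate-weaken {Γ = Γ} (ext {Δ = Δ} {T = T} D Dt) with annotate-weaken D | annotate⇐ Dt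
  ... | ts′ , mins , refl , ts⇐ | t′ , min , refl , t⇐ =
    t′ ∷ ts′ , min ∷ mins , refl ,
    ExtMSub ts⇐ (subst₂ (_⊢ t′ ⇐_) (sym (weaken-▸ Γ Δ _ [])) (sym (weaken-⟦⟧ T _ [])) t⇐)

  annotate-principal [] [] (ext _ Dt) = annotate⇒ Dt
  annotate-principal (Ξ ▹ _ ∶ _) (_ ∷ ts) (ext D _) = annotate-principal Ξ ts D

  annotate-cons {Ξc = Ξc} {T = T} {ts = ts} eq D with annotateᴹ Ξc ts D
  -- The type is literally an instance of `T`, so matching returns the declarative parameters and
  -- indices, and the index condition is reflexivity.
  ... | us , min , refl , us⇐ = us , min , refl , Cons eq (≺-instance T _) us⇐ ε

  annotate-dest {T = T} {Ξd} {U} {tpi} {ts = ts} eq D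
    with annotateᴹ Ξd ts D | annotate-principal Ξd ts D
  ... | us , mins , refl , us⇐ | T′ , t′ , T′≈ , min , refl , t⇒
    -- The inferred type is only convertible to the declared instance, so matching it yields some
    -- `w` convertible to `tpi`; the remaining arguments and the result type are converted
    -- accordingly.
    with ≺-resp-≈ (≺-instance T tpi) (≈-sym T′≈)
  ... | w , m , vw = _ , t′ , us , ⟦⟧-≈ U (++⁺-≈ᴹ ε (∷-≈ᴹ ε (≈ᴹ-sym vw))) , des min mins , refl ,
    Dest eq t⇒ m (convᴹ ≈ᶜ-refl (∷-≈ᴹ ε vw) us⇐)

theorem4p13 : ∀ {Σ : Sig} (𝕋 : Theory Σ) {γ : Scope} (Γ : Ctx Σ [] γ) → let open Judgments 𝕋 in
    (∀ (t T : Tm Σ [] γ) → [] ⨾ Γ ⊢ t ∶ T →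
    ∃[ t′ ] (MinimalC t′ × ⌜ t′ ⌝ᶜ ≡ t × (Γ ⊢ t′ ⇐ T)))
    ×
    (∀ (t T : Tm Σ [] γ) → [] ⨾ Γ ⊢ t ∶ T →
    ∃[ T′ ] ∃[ t′ ] (T′ ≈ T × MinimalI t′ × ⌜ t′ ⌝ⁱ ≡ t × (Γ ⊢ t′ ⇒ T′)))
    ×
    (∀ (T : Tm Σ [] γ) → [] ⨾ Γ ⊢ T sort →
    ∃[ T′ ] (MinimalC T′ × ⌜ T′ ⌝ᶜ ≡ T × (Γ ⊢ T′ ⇐sort)))
    ×
    (∀ {θ ξ : MScope} (Θ : MCtx Σ θ) (Ξ : MTel Σ θ ξ)
    (v : MSub Σ [] γ θ) (t : MSub Σ [] γ ξ) → [] ⨾ Γ ⊢ᴹ ++⁺ t v ∶ (Θ ⧺ Ξ) →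
    ∃[ t′ ] (MinimalM t′ × ⌜ t′ ⌝ᴹ ≡ t × (Γ ∣ v ∶ Θ ⊢ t′ ⇐ Ξ)))
theorem4p13 𝕋 Γ =
  (λ _ _ → annotate⇐) , (λ _ _ → annotate⇒) , (λ _ → annotate⇐sort) , λ _ Ξ _ t → annotateᴹ Ξ t
  where open Completeness 𝕋
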